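{- The number of arithmetical structures on $\mathcal{P}_{2,n}$ is given by: \[|\mathrm{Arith}(\mathcal{P}_{2,n})| = 9C_{n+1}-16C_n+5C_{n-1}-C_{n-2}+ \sum_{j=2}^{\lfloor\frac{n+1}{4}\rfloor} C(n+1,4j).\] In particular, $\lim_{n \to \infty} \frac{|\mathrm{Arith}(\mathcal{P}_{2,n})|}{C_{n+1}} =\frac{76523}{14400} \approx 5.3141$.
   Context: An arithmetical structure on a graph $G$ is an assignment to each vertex of a nonnegative integer label such that the set of all labels has gcd $1$ and the label of each vertex divides the sum of the labels of its neighbors, counted with multiplicity. The graph $\mathcal{P}_{2,n}$ has vertices $a_1,a_2,b_1,\ldots,b_n$, a single edge between $a_1$ and $a_2$, a single edge between $b_i$ and $b_{i+1}$ ($1\le i<n$), and two edges between $a_1$ and $b_1$. $\mathrm{Arith}(\mathcal{P}_{2,n})$ is the set of arithmetical structures, counted with the two sides distinguished. $C_n=\frac{1}{n+1}\binom{2n}{n}$ is the $n$th Catalan number and $C(n,k)=\frac{k}{n}\binom{2n-k-1}{n-1}$. -}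

module Defs where

open import Data.Nat using (ℕ; zero; suc; _+_; _*_; _∸_; _≤_)
open import Data.Nat.Divisibility using (_∣_)
open import Data.Nat.GCD using (gcd)
open import Data.Nat.DivMod using (_/_)
open import Data.Nat.Combinatorics using (_C_)
open import Data.Fin using (Fin; toℕ)
open import Data.Vec using (Vec; lookup; toList)
open import Data.List using (List; map; foldr; upTo; allFin; length)
open import Data.Nat.ListAction using (sum)
open import Relation.Binary.PropositionalEquality using (_≡_)
open import Data.List.Membership.Propositional using (_∈_)
open import Data.List.Relation.Unary.Unique.Propositional using (Unique)
open import Data.Product using (Σ; _×_)
open import Function.Bundles using (_⇔_)
open import Data.Integer as ℤ using (ℤ; +_)
open import Data.Rational as ℚ using (ℚ; 0ℚ)

Multigraph : ℕ → Set
Multigraph m = Fin m → Fin m → ℕ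

Labelling : ℕ → Set
Labelling m = Vec ℕ m

gcdAll : ∀ {m} → Labelling m → ℕ
gcdAll r = foldr gcd 0 (toList r)

neighbourSum : ∀ {m} → Multigraph m → Labelling m → Fin m → ℕ
neighbourSum {m} G r i = sum (map (λ j → G i j * lookup r j) (allFin m))

IsArith : ∀ {m} → Multigraph m → Labelling m → Set
IsArith G r = (gcdAll r ≡ 1) × (∀ i → lookup r i ∣ neighbourSum G r i)

-- The graph P_{2,n}.  Vertex order (n + 2 vertices):
--   index 0 = a₁, index 1 = a₂, index (2 + i) = b_{i+1}  (0 ≤ i < n).

pathAdj : ℕ → ℕ → ℕ
pathAdj zero (suc zero) = 1
pathAdj (suc zero) zero = 1
pathAdj (suc x) (suc y) = pathAdj x y
pathAdj _ _ = 0

P2adjℕ : ℕ → ℕ → ℕ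
P2adjℕ zero (suc zero) = 1
P2adjℕ (suc zero) zero = 1
P2adjℕ zero (suc (suc zero)) = 2
P2adjℕ (suc (suc zero)) zero = 2
P2adjℕ (suc (suc x)) (suc (suc y)) = pathAdj x y
P2adjℕ _ _ = 0

P2 : (n : ℕ) → Multigraph (2 + n)
P2 n i j = P2adjℕ (toℕ i) (toℕ j)

HasCount : {A : Set} → (A → Set) → ℕ → Set
HasCount {A} P N =
  Σ (List A) λ L → Unique L × (∀ x → (x ∈ L) ⇔ P x) × (length L ≡ N)

-- Catalan numbers C_n = (2n choose n)/(n+1) (the division is exact).

catalan : ℕ → ℕ
catalan n = ((2 * n) C n) / suc n

-- Ballot numbers C(n,k) = (k/n) * binom(2n-k-1, n-1), for n ≥ 1
-- (the division is exact; the value for n = 0 is never used).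
ballot : ℕ → ℕ → ℕ
ballot zero k = 0
ballot (suc n) k = (k * ((2 * suc n ∸ k ∸ 1) C n)) / suc n

-- the right-hand side of Theorem 4.3, as an integer (meaningful for n ≥ 2)
arithFormula : ℕ → ℤ
arithFormula n =
  ((((+ (9 * catalan (suc n)) ℤ.- + (16 * catalan n))
     ℤ.+ + (5 * catalan (n ∸ 1)))
     ℤ.- + catalan (n ∸ 2))
     ℤ.+ + sum (map (λ i → ballot (suc n) (4 * (2 + i)))
                    (upTo ((suc n / 4) ∸ 1))))

-- Rationals: a / b as a rational (total; b = 0 gives 0, never used here)

_÷ℕ_ : ℕ → ℕ → ℚ
a ÷ℕ zero = 0ℚ
a ÷ℕ suc b = (+ a) ℚ./ suc b

ConvergesTo : (ℕ → ℚ) → ℚ → Set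
ConvergesTo f L =
  ∀ (ε : ℚ) → 0ℚ ℚ.< ε →
    Σ ℕ λ N → ∀ n → N ≤ n → ℚ.∣ f n ℚ.- L ∣ ℚ.< ε

{-# OPTIONS --safe #-}
-- Write p, a, q for the labels of a₁, a₂, b₁.  Coprimality forces a ∣ 2, and the pairs (p , q) with
-- p ∣ a + 2q fall into three two-parameter families.  For fixed u = 2p and v = q the labels of the
-- b-path are the sequences u, v, w₁, …, wₘ, 0 in which each inner entry divides the sum of its
-- neighbours; if the shortest one has k entries after u (reduce v, -u mod v, …), then those of
-- length n number β n k, since w₁ runs through r, r + v, r + 2v, …, each step increasing the
-- shortest length by one, and β n k = Σ_{j ≥ k-1} β (n-1) j.  The shortest lengths are linear in
-- the two family parameters, so summing over the parameters raises the row index of β twice.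
--
-- For the limit, the sums of the rows of β over residue classes mod 4 obey a linear recursion.  Three
-- combinations e₁, e₂, e₃ of these sums are contracted by it relative to the fourfold growth of the
-- Catalan numbers, up to multiples of C_{n+1} - 4 C_n = O(C_n / n), hence are O(C_n / n).
module Submission where

open import Defs

-- Integer identities behind the limit

module Errors where
  open import Data.Integer.Base
  open import Data.Integer.Tactic.RingSolver using (solve-∀)
  open import Data.Product using (_×_; _,_)
  open import Relation.Binary.PropositionalEquality

  -- xᵢ is the sum of β n k over k ≡ i mod 4 and C = Cₙ the sum of them all.  In the limit
  -- (x₀ + x₂ - x₁ - x₃ , x₀ - x₂ , x₁ - x₃) = (-1/9 , -4/25 , 3/25) C, where all three vanish.
  e₁ e₂ e₃ : (C x₀ x₁ x₂ x₃ : ℤ) → ℤ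
  e₁ C x₀ x₁ x₂ x₃ = + 9 * (x₀ + x₂ - x₁ - x₃) + C
  e₂ C x₀ x₁ x₂ x₃ = + 25 * (x₀ - x₂) + + 4 * C
  e₃ C x₀ x₁ x₂ x₃ = + 25 * (x₁ - x₃) - + 3 * C

  -- Eliminating `y₁`, `y₂`, `y₃` and the totals leaves identities in `x₀`, ..., `x₃`, `y₀`. Up to
  -- multiples of C′ - 4 C, the triple (e₁, e₂, e₃) is transformed by a matrix with eigenvalues -1/2
  -- and (1 ± i)/2, all small against 4.
  recurrences : ∀ C C′ x₀ x₁ x₂ x₃ y₀ y₁ y₂ y₃ →
    C ≡ x₀ + x₁ + x₂ + x₃ → C′ ≡ y₀ + y₁ + y₂ + y₃ →
    y₁ ≡ x₀ + y₂ → y₂ ≡ x₁ + y₃ → y₃ ≡ x₂ + y₀ →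
    + 2 * e₁ C′ y₀ y₁ y₂ y₃ ≡ - e₁ C x₀ x₁ x₂ x₃ + + 2 * (C′ - + 4 * C) ×
    + 2 * e₂ C′ y₀ y₁ y₂ y₃ ≡ e₂ C x₀ x₁ x₂ x₃ - e₃ C x₀ x₁ x₂ x₃ + + 8 * (C′ - + 4 * C) ×
    + 2 * e₃ C′ y₀ y₁ y₂ y₃ ≡ e₂ C x₀ x₁ x₂ x₃ + e₃ C x₀ x₁ x₂ x₃ - + 6 * (C′ - + 4 * C)
  recurrences _ _ x₀ x₁ x₂ x₃ y₀ _ _ _ refl refl refl refl refl =
    identity₁ x₀ x₁ x₂ x₃ y₀ , identity₂ x₀ x₁ x₂ x₃ y₀ , identity₃ x₀ x₁ x₂ x₃ y₀
    where
    identity₁ : ∀ x₀ x₁ x₂ x₃ y₀ →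
      let y₃ = x₂ + y₀ ; y₂ = x₁ + y₃ ; y₁ = x₀ + y₂
          C = x₀ + x₁ + x₂ + x₃ ; C′ = y₀ + y₁ + y₂ + y₃ in
      + 2 * (+ 9 * (y₀ + y₂ - y₁ - y₃) + C′) ≡ - (+ 9 * (x₀ + x₂ - x₁ - x₃) + C) + + 2 * (C′ - + 4 * C)
    identity₁ = solve-∀
    identity₂ : ∀ x₀ x₁ x₂ x₃ y₀ →
      let y₃ = x₂ + y₀ ; y₂ = x₁ + y₃ ; y₁ = x₀ + y₂
          C = x₀ + x₁ + x₂ + x₃ ; C′ = y₀ + y₁ + y₂ + y₃ in
      + 2 * (+ 25 * (y₀ - y₂) + + 4 * C′)
        ≡ (+ 25 * (x₀ - x₂) + + 4 * C) - (+ 25 * (x₁ - x₃) - + 3 * C) + + 8 * (C′ - + 4 * C)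
    identity₂ = solve-∀
    identity₃ : ∀ x₀ x₁ x₂ x₃ y₀ →
      let y₃ = x₂ + y₀ ; y₂ = x₁ + y₃ ; y₁ = x₀ + y₂
          C = x₀ + x₁ + x₂ + x₃ ; C′ = y₀ + y₁ + y₂ + y₃ in
      + 2 * (+ 25 * (y₁ - y₃) - + 3 * C′)
        ≡ (+ 25 * (x₀ - x₂) + + 4 * C) + (+ 25 * (x₁ - x₃) - + 3 * C) - + 6 * (C′ - + 4 * C)
    identity₃ = solve-∀

  -- t, b, a, z are consecutive Catalan numbers, the largest first, and N is the number of structures.
  defect : ∀ N t b a z x₀ x₁ x₂ x₃ {g₂ g₁ g₀ u v} →
    N + + 17 * b + z ≡ + 9 * t + + 7 * a + x₀ → t ≡ x₀ + x₁ + x₂ + x₃ →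
    g₂ ≡ t - + 4 * b → g₁ ≡ b - + 4 * a → g₀ ≡ a - + 4 * z →
    u ≡ e₁ t x₀ x₁ x₂ x₃ → v ≡ e₂ t x₀ x₁ x₂ x₃ →
    N * + 14400 + - (+ 76523) * t ≡
    + 55125 * g₂ - + 24300 * g₁ + + 3600 * g₀ + + 400 * u + + 288 * v
  defect N t b a z x₀ x₁ x₂ x₃ {g₂} {g₁} {g₀} eq t≡ refl refl refl refl refl =
    trans (cong (λ y → y * + 14400 + - (+ 76523) * t) N≡)
      (trans (identity t b a z x₀)
        (trans (cong (λ y → + 55125 * g₂ - + 24300 * g₁ + + 3600 * g₀ + + 16 * y) (residue t x₀ x₁ x₂ x₃ t≡))
          (distribute (+ 55125 * g₂ - + 24300 * g₁ + + 3600 * g₀) _ _)))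
    where
    distribute : ∀ g u v → g + + 16 * (+ 25 * u + + 18 * v) ≡ g + + 400 * u + + 288 * v
    distribute = solve-∀
    cancel : ∀ N b z → N ≡ N + + 17 * b + z - + 17 * b - z
    cancel = solve-∀
    N≡ : N ≡ + 9 * t + + 7 * a + x₀ - + 17 * b - z
    N≡ = trans (cancel N b z) (cong (λ y → y - + 17 * b - z) eq)
    -- Comparing the coefficients of `z`, `a`, `b` in turn gives the weights 3600, -24300, 55125 of
    -- the gaps. The remainder 900 x₀ - 128 t reflects the limit 32/225 of x₀ / t.
    identity : ∀ t b a z x →
      (+ 9 * t + + 7 * a + x - + 17 * b - z) * + 14400 + - (+ 76523) * t ≡
      + 55125 * (t - + 4 * b) - + 24300 * (b - + 4 * a) + + 3600 * (a - + 4 * z)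
        + + 16 * (+ 900 * x - + 128 * t)
    identity = solve-∀
    expand : ∀ x₀ x₁ x₂ x₃ → let t = x₀ + x₁ + x₂ + x₃ in
      + 900 * x₀ - + 128 * t ≡
      + 25 * (+ 9 * (x₀ + x₂ - x₁ - x₃) + t) + + 18 * (+ 25 * (x₀ - x₂) + + 4 * t)
    expand = solve-∀
    residue : ∀ t x₀ x₁ x₂ x₃ → t ≡ x₀ + x₁ + x₂ + x₃ →
      + 900 * x₀ - + 128 * t ≡ + 25 * e₁ t x₀ x₁ x₂ x₃ + + 18 * e₂ t x₀ x₁ x₂ x₃
    residue _ x₀ x₁ x₂ x₃ refl = expand x₀ x₁ x₂ x₃

open import Data.Empty using (⊥; ⊥-elim)
open import Data.Fin.Base using (Fin; toℕ; zero; suc)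
open import Data.List.Base as List using (List; []; _∷_; _++_; applyUpTo; length; map; tabulate; upTo)
open import Data.List.Properties using (length-++; length-map; map-tabulate; map-upTo)
open import Data.List.Membership.Propositional using (_∈_)
open import Data.List.Membership.Propositional.Properties
  using (∈-map⁺; ∈-map⁻; ∈-++⁺ˡ; ∈-++⁺ʳ; ∈-++⁻)
open import Data.List.Membership.Propositional.Properties.WithK using (unique∧set⇒bag)
open import Data.List.Relation.Binary.BagAndSetEquality using (∼bag⇒↭)
open import Data.List.Relation.Binary.Permutation.Propositional.Properties using (↭-length)
open import Data.List.Relation.Unary.All as All using ([]; _∷_)
import Data.List.Relation.Unary.All.Properties as All
open import Data.List.Relation.Unary.AllPairs using ([]; _∷_)
open import Data.List.Relation.Unary.Any using (here; there)
open import Data.List.Relation.Unary.Unique.Propositional using (Unique)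
import Data.List.Relation.Unary.Unique.Propositional.Properties as Unique
open import Data.Nat hiding (parity)
open import Data.Nat.Combinatorics
  using (_C_; k>n⇒nCk≡0; nCn≡1; nC1≡n; nCk≡nC[n∸k]; nCk+nC[k+1]≡[n+1]C[k+1])
open import Data.Nat.Coprimality using (Coprime; 1-coprimeTo; coprime-divisor)
open import Data.Nat.Divisibility
open import Data.Nat.DivMod using (m*n/n≡m; m/n*n≤m; m%n<n; m≡m%n+[m/n]*n)
open import Data.Nat.GCD using (gcd[m,n]∣m; gcd[m,n]∣n; gcd-greatest)
open import Data.Nat.ListAction using (sum)
open import Data.Nat.Properties
open import Data.Nat.Tactic.RingSolver using (solve-∀)
open import Data.Product using (Σ; _×_; _,_; proj₁; proj₂; ∃; map₁)
open import Data.Sum using (_⊎_; inj₁; inj₂; [_,_]′)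
open import Data.Unit.Base using (tt)
open import Data.Vec.Base as Vec using (Vec; []; _∷_; lookup)
open import Function.Base using (_∘_; id)
open import Function.Bundles using (_⇔_; mk⇔; module Equivalence)
import Function.Properties.Equivalence as ⇔
open import Relation.Binary.PropositionalEquality
open import Relation.Nullary using (¬_; contradiction)
open import Relation.Nullary.Decidable using (from-yes)

private variable
  A A′ : Set
  P Q : A → Set
  f g : ℕ → ℕ
  k m r u v M N : ℕ

-- Counting and finitely supported sums

-- Duplicate-free lists with the same members are permutations of each other. This carries the limit
-- over to an arbitrary counting function.
count-unique : HasCount P M → HasCount P N → M ≡ N
count-unique (xs , xs! , xs⇔ , refl) (ys , ys! , ys⇔ , refl) =
  ↭-length (∼bag⇒↭ (unique∧set⇒bag xs! ys! λ {x} → ⇔.trans (xs⇔ x) (⇔.sym (ys⇔ x))))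

count-⇔ : (∀ x → P x ⇔ Q x) → HasCount P N → HasCount Q N
count-⇔ P⇔Q (xs , xs! , xs⇔ , len) = xs , xs! , (λ x → ⇔.trans (xs⇔ x) (P⇔Q x)) , len

count-∅ : (∀ x → ¬ P x) → HasCount P 0
count-∅ ¬P = [] , [] , (λ x → mk⇔ (λ ()) (⊥-elim ∘ ¬P x)) , refl

count0⇒∅ : HasCount P 0 → ∀ x → ¬ P x
count0⇒∅ ([] , _ , xs⇔ , refl) x Px with () ← Equivalence.from (xs⇔ x) Px

count-singleton : ∀ x → P x → (∀ y → P y → y ≡ x) → HasCount P 1
count-singleton {P = P} x Px only =
  (x ∷ []) , ([] ∷ []) , (λ y → mk⇔ (λ { (here refl) → Px }) (here ∘ only y)) , refl

unique-map : (h : A → A′) {xs : List A} → (∀ {x y} → x ∈ xs → y ∈ xs → h x ≡ h y → x ≡ y) →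
             Unique xs → Unique (List.map h xs)
unique-map h inj [] = []
unique-map h inj (x∉xs ∷ xs!) =
  All.map⁺ (All.tabulate λ y∈xs hx≡hy → All.lookup x∉xs y∈xs (inj (here refl) (there y∈xs) hx≡hy))
  ∷ unique-map h (λ p q → inj (there p) (there q)) xs!

count-map : (h : A → A′) → (∀ {x} → P x → Q (h x)) →
            (∀ {x y} → P x → P y → h x ≡ h y → x ≡ y) →
            (∀ {y} → Q y → ∃ λ x → P x × h x ≡ y) →
            HasCount P N → HasCount Q N
count-map {Q = Q} h to inj sur (xs , xs! , xs⇔ , len) =
  List.map h xs
  , unique-map h (λ p q → inj (Equivalence.to (xs⇔ _) p) (Equivalence.to (xs⇔ _) q)) xs!
  , (λ y → mk⇔
      (λ y∈ → let x , x∈xs , y≡hx = ∈-map⁻ h y∈ in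
               subst Q (sym y≡hx) (to (Equivalence.to (xs⇔ x) x∈xs)))
      (λ Qy → let x , Px , hx≡y = sur Qy in
               subst (_∈ _) hx≡y (∈-map⁺ h (Equivalence.from (xs⇔ x) Px))))
  , trans (length-map h xs) len

count-⊎ : (∀ {x} → P x → Q x → ⊥) → HasCount P M → HasCount Q N →
          HasCount (λ x → P x ⊎ Q x) (M + N)
count-⊎ disj (xs , xs! , xs⇔ , refl) (ys , ys! , ys⇔ , refl) =
  xs ++ ys
  , Unique.++⁺ xs! ys! (λ (p , q) → disj (Equivalence.to (xs⇔ _) p) (Equivalence.to (ys⇔ _) q))
  , (λ z → mk⇔
      (λ z∈ → [ inj₁ ∘ Equivalence.to (xs⇔ z) , inj₂ ∘ Equivalence.to (ys⇔ z) ]′ (∈-++⁻ xs z∈))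
      [ ∈-++⁺ˡ ∘ Equivalence.from (xs⇔ z) , ∈-++⁺ʳ xs ∘ Equivalence.from (ys⇔ z) ]′)
  , length-++ xs

-- HasSum f N: the finitely supported sequence f has total N.
data HasSum : (ℕ → ℕ) → ℕ → Set where
  zeros : (∀ i → f i ≡ 0) → HasSum f 0
  cons  : HasSum (f ∘ suc) N → HasSum f (f 0 + N)

hasSum-cong : (∀ i → f i ≡ g i) → HasSum f N → HasSum g N
hasSum-cong f≗g (zeros f≗0) = zeros λ i → trans (sym (f≗g i)) (f≗0 i)
hasSum-cong f≗g (cons s) rewrite f≗g 0 = cons (hasSum-cong (f≗g ∘ suc) s)

hasSum-+ : HasSum f M → HasSum g N → HasSum (λ i → f i + g i) (M + N)
hasSum-+ {g = g} (zeros f≗0) t = hasSum-cong (λ i → cong (_+ g i) (sym (f≗0 i))) t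
hasSum-+ {f = f} s@(cons _) (zeros g≗0) = subst (HasSum _) (sym (+-identityʳ _))
  (hasSum-cong (λ i → trans (sym (+-identityʳ (f i))) (cong (f i +_) (sym (g≗0 i)))) s)
hasSum-+ {f} {g = g} (cons {N = M} s) (cons {N = N} t) =
  subst (HasSum _) (interchange (f 0) (g 0) M N) (cons (hasSum-+ s t))
  where
  interchange : ∀ x y z w → x + y + (z + w) ≡ x + z + (y + w)
  interchange = solve-∀

hasSum-zeros : (∀ i → f i ≡ 0) → HasSum f N → N ≡ 0
hasSum-zeros f≗0 (zeros _) = refl
hasSum-zeros f≗0 (cons s)  = cong₂ _+_ (f≗0 0) (hasSum-zeros (f≗0 ∘ suc) s)

hasSum-unique : HasSum f M → HasSum f N → M ≡ N
hasSum-unique (zeros f≗0) t = sym (hasSum-zeros f≗0 t)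
hasSum-unique s@(cons _) (zeros f≗0) = hasSum-zeros f≗0 s
hasSum-unique {f} (cons s) (cons t) = cong (f 0 +_) (hasSum-unique s t)

-- The fibre over 0 is split off and the others are shifted down, in step with `HasSum`; under
-- `zeros` every fibre is empty.
count-Σ : {Q : ℕ → A → Set} → (∀ i → HasCount (Q i) (f i)) → HasSum f N →
          HasCount {ℕ × A} (λ (i , x) → Q i x) N
count-Σ {Q = Q} counts (zeros f≗0) =
  count-∅ λ (i , x) → count0⇒∅ (subst (HasCount (Q i)) (f≗0 i) (counts i)) x
count-Σ {A} {Q = Q} counts (cons s) =
  count-⇔
    (λ { (zero , x) → mk⇔ (λ { (inj₁ (_ , q)) → q ; (inj₂ (() , _)) }) (λ q → inj₁ (refl , q))
       ; (suc i , x) → mk⇔ (λ { (inj₁ (() , _)) ; (inj₂ (_ , q)) → q }) (λ q → inj₂ (_ , q)) })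
    (count-⊎
      {P = λ (i , x) → i ≡ 0 × Q i x} {Q = λ (i , x) → NonZero i × Q i x}
      (λ { (refl , _) (() , _) })
      (count-map (0 ,_) (refl ,_) (λ { _ _ refl → refl }) (λ { (refl , q) → _ , q , refl }) (counts 0))
      (count-map (map₁ suc) (_ ,_) (λ { {_ , _} {_ , _} _ _ refl → refl })
        (λ { {suc i , x} (_ , q) → (i , x) , q , refl })
        (count-Σ (counts ∘ suc) s)))

-- The ballot triangle

-- Stands in for the infinite tail sum over j ≥ k. In `β` a window of `suc n` entries suffices,
-- since row `n` vanishes beyond `n`.
window : (ℕ → ℕ) → ℕ → ℕ → ℕ
window f zero    k = 0
window f (suc t) k = f k + window f t (suc k)

-- β n k is the coefficient of z^(n-k) in the kth power of the Catalan generating function.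
β : ℕ → ℕ → ℕ
β zero    zero    = 1
β zero    (suc k) = 0
β (suc n) zero    = 0
β (suc n) (suc k) = window (β n) (suc n) k

window-zeros : (∀ {j} → k ≤ j → f j ≡ 0) → ∀ t → window f t k ≡ 0
window-zeros f≗0 zero    = refl
window-zeros f≗0 (suc t) =
  cong₂ _+_ (f≗0 ≤-refl) (window-zeros (λ k<j → f≗0 (<⇒≤ k<j)) t)

β-vanishes : ∀ {n k} → n < k → β n k ≡ 0
β-vanishes {zero}  {suc k} _         = refl
β-vanishes {suc n} {suc k} (s≤s n<k) =
  window-zeros (λ k≤j → β-vanishes (≤-trans n<k k≤j)) (suc n)

window-end : ∀ t k → f (t + k) ≡ 0 → window f (suc t) k ≡ window f t k
window-end {f} zero    k eq = trans (+-identityʳ (f k)) eq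
window-end {f} (suc t) k eq = cong (f k +_) (window-end t (suc k) (trans (cong f (+-suc t k)) eq))

-- The tails from `k` and from `suc k` differ by one entry. As both windows have the same length,
-- the second also reaches one place further, where row `n` vanishes.
β-suc : ∀ n k → β (suc n) (suc k) ≡ β n k + β (suc n) (suc (suc k))
β-suc n k = cong (β n k +_) (sym (window-end n (suc k) (β-vanishes (m<m+n n (s≤s z≤n)))))

-- Entries are peeled off until the index exceeds `n`; `t` bounds how many are left.
hasSum-β : ∀ n k → HasSum (λ i → β n (i + k)) (β (suc n) (suc k))
hasSum-β n k = go (suc n) k (m≤m+n (suc n) k)
  where
  go : ∀ t k → n < t + k → HasSum (λ i → β n (i + k)) (β (suc n) (suc k))
  go zero k n<k = subst (HasSum _) (sym (β-vanishes (s≤s n<k)))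
    (zeros λ i → β-vanishes (≤-trans n<k (m≤n+m k i)))
  go (suc t) k n<t+k = subst (HasSum _) (sym (β-suc n k))
    (cons (hasSum-cong (λ i → cong (β n) (+-suc i k))
      (go t (suc k) (subst (n <_) (sym (+-suc t k)) n<t+k))))

-- The sequence a, b, a + 1, b + 1, a + 2, b + 2, …
steps : ℕ → ℕ → ℕ → ℕ
steps a b zero    = a
steps a b (suc i) = steps b (suc a) i

steps-> : ∀ {n a b} → n < a → n < b → ∀ i → n < steps a b i
steps-> n<a n<b zero    = n<a
steps-> n<a n<b (suc i) = steps-> n<b (m<n⇒m<1+n n<a) i

-- `steps a b` interleaves the tails from `a` and from `b`, and each tail of row `n` sums to an
-- entry of the next row.
hasSum-steps : ∀ n a b → HasSum (β n ∘ steps a b) (β (suc n) (suc a) + β (suc n) (suc b))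
hasSum-steps n a b = go (suc n) a b (m≤m+n (suc n) a) (m≤m+n (suc n) b)
  where
  go : ∀ t a b → n < t + a → n < t + b →
       HasSum (β n ∘ steps a b) (β (suc n) (suc a) + β (suc n) (suc b))
  go zero a b n<a n<b =
    subst (HasSum _) (sym (cong₂ _+_ (β-vanishes (s≤s n<a)) (β-vanishes (s≤s n<b))))
      (zeros (β-vanishes ∘ steps-> n<a n<b))
  go (suc t) a b n<t+a n<t+b =
    subst (HasSum _)
      (trans (rearrange (β n a) (β n b) _ _) (sym (cong₂ _+_ (β-suc n a) (β-suc n b))))
      (cons (cons (go t (suc a) (suc b) (subst (n <_) (sym (+-suc t a)) n<t+a)
                                        (subst (n <_) (sym (+-suc t b)) n<t+b))))
    where
    rearrange : ∀ x y z w → x + (y + (z + w)) ≡ x + z + (y + w)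
    rearrange = solve-∀

-- Chains along the path b₁, …, bₙ

-- Chain u v (w₁ ∷ … ∷ wₘ): in the sequence u, v, w₁, …, wₘ, 0 every entry from v to wₘ is
-- positive and divides the sum of its two neighbours.
Chain : ℕ → ℕ → ∀ {n} → Vec ℕ n → Set
Chain u v []       = 0 < v × v ∣ u
Chain u v (w ∷ ws) = 0 < v × v ∣ u + w × Chain v w ws

-- The shortest chain starting from u, v has k entries after u.
data Length : ℕ → ℕ → ℕ → Set where
  stop : Length u 0 0
  step : r < v → v ∣ u + r → Length v r k → Length u v (suc k)

-- The first step sees `u` only modulo `v`, and later steps do not see it at all.
length-+ : Length u v k → Length (u + v) v k
length-+ stop = stop
length-+ {u} {v} (step {r = r} r<v v∣u+r l) =
  step r<v (subst (v ∣_) (rearrange u r v) (∣m∣n⇒∣m+n v∣u+r ∣-refl)) l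
  where
  rearrange : ∀ u r v → u + r + v ≡ u + v + r
  rearrange = solve-∀

-- Between `v` and `r` the new entry `r + v` is inserted, the sum of its neighbours. The entries
-- after `r` stay, because `v` and `r + v` agree modulo `r`.
length-extend : 0 < v → Length v r k → Length v (r + v) (suc k)
length-extend {v} {r} {k} 0<v l =
  step (m<m+n r 0<v) (∣-reflexive (+-comm r v))
    (subst (λ x → Length x r k) (+-comm v r) (length-+ l))

length-progression : 0 < v → Length v r k → ∀ i → Length v (r + i * v) (i + k)
length-progression {r = r} {k} 0<v l zero = subst (λ x → Length _ x k) (sym (+-identityʳ r)) l
length-progression {v} {r} {k} 0<v l (suc i) =
  subst (λ x → Length v x (suc i + k)) (rearrange r (i * v) v) (length-extend 0<v (length-progression 0<v l i))
  where
  rearrange : ∀ r x v → r + x + v ≡ r + (v + x)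
  rearrange = solve-∀

-- Both `r` and `w` are congruent to -u modulo `v`, and `r < v` is the least member of that class.
least-residue : ∀ {w} → r < v → v ∣ u + r → v ∣ u + w → ∃ λ i → r + i * v ≡ w
least-residue {r} {v} {u} {w} r<v v∣u+r v∣u+w with ≤-total r w
... | inj₁ r≤w with ∣m+n∣m⇒∣n (subst (v ∣_) eq v∣u+w) v∣u+r
  where
  eq : u + w ≡ u + r + (w ∸ r)
  eq = trans (cong (u +_) (sym (m+[n∸m]≡n r≤w))) (sym (+-assoc u r _))
... | divides i w∸r≡ = i , trans (cong (r +_) (sym w∸r≡)) (m+[n∸m]≡n r≤w)
least-residue {r} {v} {u} {w} r<v v∣u+r v∣u+w | inj₂ w≤r = 0 , trans (+-identityʳ r) r≡w
  where
  eq : u + r ≡ u + w + (r ∸ w)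
  eq = trans (cong (u +_) (sym (m+[n∸m]≡n w≤r))) (sym (+-assoc u w _))
  v∣r∸w : v ∣ r ∸ w
  v∣r∸w = ∣m+n∣m⇒∣n (subst (v ∣_) eq v∣u+r) v∣u+w
  r≡w : r ≡ w
  r≡w with r ∸ w in e
  ... | zero = ≤-antisym (m∸n≡0⇒m≤n e) w≤r
  ... | suc d = ⊥-elim (<⇒≱ r<v (≤-trans (∣⇒≤ (subst (v ∣_) e v∣r∸w)) (subst (_≤ r) e (m∸n≤m r w))))

-- The next entry is some `r + i * v`, from which the shortest length is `i + k`; summing over `i`
-- gives a tail of a row. The row is `suc n` because `v` itself counts as an entry.
count-Chain : ∀ n → Length u v k → HasCount (Chain u v {n}) (β (suc n) k)
count-Chain zero    stop = count-∅ λ { [] (() , _) }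
count-Chain (suc n) stop = count-∅ λ { (_ ∷ _) (() , _) }
count-Chain {u} {v} zero (step r<v v∣u+0 stop) =
  count-singleton [] (r<v , subst (v ∣_) (+-identityʳ u) v∣u+0) λ { [] _ → refl }
-- Here 0 < r < v, so `v` does not divide `u` and the chain cannot end at `v`.
count-Chain zero (step r<v v∣u+r (step {v = r} r′<r _ _)) =
  count-∅ λ { [] (_ , v∣u) →
    <⇒≱ r<v (∣⇒≤ {{>-nonZero (≤-<-trans z≤n r′<r)}} (∣m+n∣m⇒∣n v∣u+r v∣u)) }
count-Chain {u} {v} (suc n) (step {r = r} {k = k} r<v v∣u+r l) =
  count-map (λ (i , ws) → (r + i * v) ∷ ws)
    (λ {(i , ws)} ch → 0<v , subst (v ∣_) (+-assoc u r (i * v)) (∣m∣n⇒∣m+n v∣u+r (n∣m*n i)) , ch)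
    (λ { {i , ws} {j , ws′} _ _ eq → cong₂ _,_ (injective i j (cong Vec.head eq)) (cong Vec.tail eq) })
    (λ { {w ∷ ws} (_ , v∣u+w , ch) →
         let i , eq = least-residue {u = u} r<v v∣u+r v∣u+w in
         (i , ws) , subst (λ x → Chain v x ws) (sym eq) ch , cong (_∷ ws) eq })
    (count-Σ (λ i → count-Chain n (length-progression 0<v l i)) (hasSum-β (suc n) k))
  where
  0<v : 0 < v
  0<v = ≤-<-trans z≤n r<v
  injective : ∀ i j → r + i * v ≡ r + j * v → i ≡ j
  injective i j eq = *-cancelʳ-≡ i j v {{>-nonZero 0<v}} (+-cancelˡ-≡ r _ _ eq)

-- In the application `u` is twice the difference of the progression `q`, so two progressions of
-- difference `u` alternate; along each the shortest length grows by one per term.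
length-steps : ∀ {a b} (q : ℕ → ℕ) → 0 < u → (∀ i → q (2 + i) ≡ q i + u) →
               Length u (q 0) a → Length u (q 1) b → ∀ i → Length u (q i) (steps a b i)
length-steps q 0<u rec l₀ l₁ zero    = l₀
length-steps {a = a} q 0<u rec l₀ l₁ (suc i) =
  length-steps (q ∘ suc) 0<u (rec ∘ suc) l₁
    (subst (λ x → Length _ x (suc a)) (sym (rec 0)) (length-extend 0<u l₀)) i

count-steps : ∀ {a b} n (q : ℕ → ℕ) → 0 < u → (∀ i → q (2 + i) ≡ q i + u) →
              Length u (q 0) a → Length u (q 1) b →
              HasCount {ℕ × Vec ℕ n} (λ (i , ws) → Chain u (q i) ws)
                (β (2 + n) (suc a) + β (2 + n) (suc b))
count-steps {a = a} {b} n q 0<u rec l₀ l₁ =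
  count-Σ (λ i → count-Chain n (length-steps q 0<u rec l₀ l₁ i)) (hasSum-steps (suc n) a b)

-- Arithmetical structures as chains

sum-tabulate-zeros : ∀ {n} {f : Fin n → ℕ} → (∀ i → f i ≡ 0) → sum (tabulate f) ≡ 0
sum-tabulate-zeros {zero}  f≗0 = refl
sum-tabulate-zeros {suc n} f≗0 = cong₂ _+_ (f≗0 zero) (sum-tabulate-zeros (f≗0 ∘ suc))

pathSum : Vec ℕ m → Fin m → ℕ
pathSum ws i = sum (tabulate λ j → pathAdj (toℕ i) (toℕ j) * lookup ws j)

atZero : ℕ → Fin m → ℕ
atZero u zero    = u
atZero u (suc _) = 0

-- The bare divisibility conditions along the path, where labels may still be zero.
WeakChain : ℕ → ℕ → ∀ {n} → Vec ℕ n → Set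
WeakChain u v []       = v ∣ u
WeakChain u v (w ∷ ws) = v ∣ u + w × WeakChain v w ws

pathSum-zero : ∀ v w (ws : Vec ℕ m) → pathSum (v ∷ w ∷ ws) zero ≡ w
pathSum-zero {m} v w ws =
  trans (cong (w + 0 +_) (sum-tabulate-zeros {f = λ (_ : Fin m) → 0} λ _ → refl))
    (trans (+-identityʳ (w + 0)) (+-identityʳ w))

pathSum-suc : ∀ v (ws : Vec ℕ m) i → pathSum (v ∷ ws) (suc i) ≡ atZero v i + pathSum ws i
pathSum-suc v ws zero    = cong (_+ pathSum ws zero) (+-identityʳ v)
pathSum-suc v ws (suc i) = refl

module _ where
  open Equivalence

  -- By induction along the path: for the rest of the path, `v` takes the role of `u`.
  pathSum⇔WeakChain : ∀ u v (ws : Vec ℕ m) →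
    (∀ i → lookup (v ∷ ws) i ∣ atZero u i + pathSum (v ∷ ws) i) ⇔ WeakChain u v ws
  pathSum⇔WeakChain u v [] = mk⇔
    (λ h → subst (v ∣_) (+-identityʳ u) (h zero))
    (λ { v∣u zero → subst (v ∣_) (sym (+-identityʳ u)) v∣u })
  pathSum⇔WeakChain u v (w ∷ ws) = mk⇔
    (λ h → subst (λ x → v ∣ u + x) (pathSum-zero v w ws) (h zero)
         , to (pathSum⇔WeakChain v w ws) λ i →
             subst (lookup (w ∷ ws) i ∣_) (pathSum-suc v (w ∷ ws) i) (h (suc i)))
    (λ { (d , ch) zero → subst (λ x → v ∣ u + x) (sym (pathSum-zero v w ws)) d
       ; (d , ch) (suc i) → subst (lookup (w ∷ ws) i ∣_) (sym (pathSum-suc v (w ∷ ws) i))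
                              (from (pathSum⇔WeakChain v w ws) ch i) })

chain⇒weak : ∀ {n} {ws : Vec ℕ n} → Chain u v ws → WeakChain u v ws
chain⇒weak {ws = []}     (_ , d)      = d
chain⇒weak {ws = _ ∷ _}  (_ , d , ch) = d , chain⇒weak ch

-- Zero divides only zero, so positivity of `u` forces that of `v` and propagates.
weak⇒chain : ∀ {n} {ws : Vec ℕ n} → 0 < u → WeakChain u v ws → Chain u v ws
weak⇒chain {u} {zero}  {ws = []}    0<u d = contradiction (0∣⇒≡0 d) (n>0⇒n≢0 0<u)
weak⇒chain {u} {suc v} {ws = []}    0<u d = s≤s z≤n , d
weak⇒chain {u} {zero}  {ws = _ ∷ _} 0<u (d , _) =
  contradiction (m+n≡0⇒m≡0 u (0∣⇒≡0 d)) (n>0⇒n≢0 0<u)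
weak⇒chain {u} {suc v} {ws = _ ∷ _} 0<u (d , ch) = s≤s z≤n , d , weak⇒chain (s≤s z≤n) ch

-- If `d` divides `u` and `v`, then `v ∣ u + w` gives `d ∣ w`: a common divisor of two consecutive
-- labels passes down the path.
∣weakChain⇒∣gcdAll : ∀ {d n} (ws : Vec ℕ n) → d ∣ u → d ∣ v → WeakChain u v ws → d ∣ gcdAll (v ∷ ws)
∣weakChain⇒∣gcdAll {d = d} [] d∣u d∣v _ = gcd-greatest d∣v (d ∣0)
∣weakChain⇒∣gcdAll (w ∷ ws) d∣u d∣v (v∣u+w , ch) =
  gcd-greatest d∣v (∣weakChain⇒∣gcdAll ws d∣v (∣m+n∣m⇒∣n (∣-trans d∣v v∣u+w) d∣u) ch)

Solution : Labelling (3 + m) → Set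
Solution (p ∷ a ∷ q ∷ ws) = 0 < p × a ∣ p × p ∣ a + 2 * q × Coprime a q × Chain (2 * p) q ws

neighbourSum-tabulate : (G : Multigraph m) (r : Labelling m) (i : Fin m) →
  neighbourSum G r i ≡ sum (tabulate λ j → G i j * lookup r j)
neighbourSum-tabulate G r i = cong sum (map-tabulate id (λ j → G i j * lookup r j))

neighbourSum-a₁ : ∀ p a q (ws : Vec ℕ m) →
  neighbourSum (P2 (suc m)) (p ∷ a ∷ q ∷ ws) zero ≡ a + 2 * q
neighbourSum-a₁ {m} p a q ws = trans (neighbourSum-tabulate (P2 (suc m)) (p ∷ a ∷ q ∷ ws) zero)
  (trans (cong (λ z → a + 0 + (2 * q + z)) (sum-tabulate-zeros {f = λ (_ : Fin m) → 0} λ _ → refl))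
    (cong₂ _+_ (+-identityʳ a) (+-identityʳ (2 * q))))

neighbourSum-a₂ : ∀ p a q (ws : Vec ℕ m) →
  neighbourSum (P2 (suc m)) (p ∷ a ∷ q ∷ ws) (suc zero) ≡ p
neighbourSum-a₂ {m} p a q ws = trans (neighbourSum-tabulate (P2 (suc m)) (p ∷ a ∷ q ∷ ws) (suc zero))
  (trans (cong (p + 0 +_) (sum-tabulate-zeros {f = λ (_ : Fin m) → 0} λ _ → refl))
    (trans (+-identityʳ (p + 0)) (+-identityʳ p)))

neighbourSum-b : ∀ p a q (ws : Vec ℕ m) i →
  neighbourSum (P2 (suc m)) (p ∷ a ∷ q ∷ ws) (suc (suc i)) ≡ atZero (2 * p) i + pathSum (q ∷ ws) i
neighbourSum-b p a q ws zero    = neighbourSum-tabulate (P2 _) (p ∷ a ∷ q ∷ ws) (suc (suc zero))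
neighbourSum-b p a q ws (suc i) = neighbourSum-tabulate (P2 _) (p ∷ a ∷ q ∷ ws) (suc (suc (suc i)))

-- A common divisor of `a` and `q` divides `p`, as `a ∣ p`, and then every label; so gcd 1 amounts
-- to coprimality of `a` and `q`. The double edge makes `2 * p` the entry before the path.
isArith⇔Solution : (r : Labelling (3 + m)) → IsArith (P2 (suc m)) r ⇔ Solution r
isArith⇔Solution {m} r@(p ∷ a ∷ q ∷ ws) = mk⇔ to from
  where
  to : IsArith (P2 (suc m)) r → Solution r
  to (gcd≡1 , h) = 0<p , a∣p , p∣a+2q , coprime , weak⇒chain (*-monoʳ-< 2 0<p) weak
    where
    a∣p : a ∣ p
    a∣p = subst (a ∣_) (neighbourSum-a₂ p a q ws) (h (suc zero))
    p∣a+2q : p ∣ a + 2 * q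
    p∣a+2q = subst (p ∣_) (neighbourSum-a₁ p a q ws) (h zero)
    weak : WeakChain (2 * p) q ws
    weak = Equivalence.to (pathSum⇔WeakChain (2 * p) q ws) λ i →
      subst (lookup (q ∷ ws) i ∣_) (neighbourSum-b p a q ws i) (h (suc (suc i)))
    coprime : Coprime a q
    coprime (d∣a , d∣q) = ∣1⇒≡1 (subst (_ ∣_) gcd≡1
      (gcd-greatest d∣p (gcd-greatest d∣a (∣weakChain⇒∣gcdAll ws (∣n⇒∣m*n 2 d∣p) d∣q weak))))
      where d∣p = ∣-trans d∣a a∣p
    -- If `p` were 0, then a + 2q = 0, so 0 would be a common divisor of `a` and `q`.
    0<p : 0 < p
    0<p = n≢0⇒n>0 λ p≡0 → contradiction
      (coprime (∣-reflexive (sym (a≡0 p≡0)) , ∣-reflexive (sym (q≡0 p≡0)))) λ ()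
      where
      a+2q≡0 : p ≡ 0 → a + 2 * q ≡ 0
      a+2q≡0 p≡0 = 0∣⇒≡0 (subst (_∣ a + 2 * q) p≡0 p∣a+2q)
      a≡0 : p ≡ 0 → a ≡ 0
      a≡0 p≡0 = m+n≡0⇒m≡0 a (a+2q≡0 p≡0)
      q≡0 : p ≡ 0 → q ≡ 0
      q≡0 p≡0 = m+n≡0⇒m≡0 q (m+n≡0⇒n≡0 a (a+2q≡0 p≡0))
  from : Solution r → IsArith (P2 (suc m)) r
  from (0<p , a∣p , p∣a+2q , coprime , chain) = coprime (g∣a , g∣q) , divides-sum
    where
    g∣rest = gcd[m,n]∣n p (gcdAll (a ∷ q ∷ ws))
    g∣a = ∣-trans g∣rest (gcd[m,n]∣m a (gcdAll (q ∷ ws)))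
    g∣q = ∣-trans g∣rest (∣-trans (gcd[m,n]∣n a (gcdAll (q ∷ ws))) (gcd[m,n]∣m q (gcdAll ws)))
    divides-sum : ∀ i → lookup r i ∣ neighbourSum (P2 (suc m)) r i
    divides-sum zero          = subst (p ∣_) (sym (neighbourSum-a₁ p a q ws)) p∣a+2q
    divides-sum (suc zero)    = subst (a ∣_) (sym (neighbourSum-a₂ p a q ws)) a∣p
    divides-sum (suc (suc i)) = subst (lookup (q ∷ ws) i ∣_) (sym (neighbourSum-b p a q ws i))
      (Equivalence.from (pathSum⇔WeakChain (2 * p) q ws) (chain⇒weak chain) i)

-- The three families

-- For given p, the admissible q form an arithmetic progression with difference p and least term c.
InFamily : ℕ → (ℕ → ℕ) → (ℕ → ℕ) → Labelling (3 + m) → Set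
InFamily a p c (p′ ∷ a′ ∷ q ∷ ws) =
  a′ ≡ a × ∃ λ x → p′ ≡ p x × (∃ λ i → q ≡ i * p x + c x) × Chain (2 * p′) q ws

-- For fixed `x`, `q` advances by `p x`, half of the entry 2p before it. Its two interleaved
-- progressions start at `c x` and `p x + c x`, with shortest lengths `s x` and `t x`.
count-family : ∀ m a (p c s t : ℕ → ℕ) →
  (∀ x → 0 < p x) → (∀ {x y} → p x ≡ p y → x ≡ y) →
  (∀ x → Length (2 * p x) (c x) (s x)) → (∀ x → Length (2 * p x) (p x + c x) (t x)) →
  HasSum (λ x → β (2 + m) (suc (s x))) M → HasSum (λ x → β (2 + m) (suc (t x))) N →
  HasCount (InFamily {m} a p c) (M + N)
count-family m a p c s t p>0 p-injective ls lt sumS sumT =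
  count-map label
    (λ {(x , i , ws)} ch → refl , x , refl , (i , refl) , ch)
    injective
    (λ { {p′ ∷ a′ ∷ q ∷ ws} (refl , x , refl , (i , refl) , ch) → (x , i , ws) , ch , refl })
    (count-Σ
      {Q = λ x (i , ws) → Chain (2 * p x) (i * p x + c x) ws}
      (λ x → count-steps m (λ i → i * p x + c x) (*-monoʳ-< 2 (p>0 x)) (λ i → recurrence i (p x) (c x))
        (ls x) (subst (λ z → Length (2 * p x) (z + c x) (t x)) (sym (*-identityˡ (p x))) (lt x)))
      (hasSum-+ sumS sumT))
  where
  label : ℕ × ℕ × Vec ℕ m → Labelling (3 + m)
  label (x , i , ws) = p x ∷ a ∷ (i * p x + c x) ∷ ws
  recurrence : ∀ i y z → (2 + i) * y + z ≡ i * y + z + 2 * y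
  recurrence = solve-∀
  injective : ∀ {y z} → _ → _ → label y ≡ label z → y ≡ z
  injective {x , i , ws} {x′ , i′ , ws′} _ _ eq with p-injective (cong Vec.head eq)
  ... | refl = cong₂ (λ j vs → x , j , vs)
    (*-cancelʳ-≡ i i′ (p x) {{>-nonZero (p>0 x)}}
      (+-cancelʳ-≡ (c x) _ _ (cong (Vec.head ∘ Vec.tail ∘ Vec.tail) eq)))
    (cong (Vec.tail ∘ Vec.tail ∘ Vec.tail) eq)

even∨odd : ∀ n → (∃ λ h → n ≡ 2 * h) ⊎ (∃ λ h → n ≡ suc (2 * h))
even∨odd zero = inj₁ (0 , refl)
even∨odd (suc n) with even∨odd n
... | inj₁ (h , eq) = inj₂ (h , cong suc eq)
... | inj₂ (h , eq) = inj₁ (suc h , trans (cong suc eq) (cong suc (sym (+-suc h _))))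

-- OddPair: a = 1, so (1 + 2q) / p and p are odd.  For a = 2 the quotient (2 + 2q) / p is even in
-- EvenPair and odd in QuadPair; as q is odd, the latter forces 4 ∣ p.
OddPair EvenPair QuadPair : Labelling (3 + m) → Set
OddPair  = InFamily 1 (λ x → suc (2 * x))     (λ x → x)
EvenPair = InFamily 2 (λ x → 2 * suc x)       (λ x → suc (2 * x))
QuadPair = InFamily 2 (λ x → 2 * (2 * suc x)) (λ x → suc (2 * x))

coprime-2-odd : ∀ x → Coprime 2 (suc (2 * x))
coprime-2-odd x {d} (d∣2 , d∣q) = ∣1⇒≡1
  (∣m+n∣m⇒∣n (subst (d ∣_) (+-comm 1 (2 * x)) d∣q) (∣m⇒∣m*n {d} {2} x d∣2))

-- The witnesses of divisibility are the quotients (a + 2q) / p: odd, even and odd.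
family⇒Solution : (r : Labelling (3 + m)) → OddPair r ⊎ EvenPair r ⊎ QuadPair r → Solution r
family⇒Solution (_ ∷ _ ∷ _ ∷ ws) (inj₁ (refl , x , refl , (i , refl) , ch)) =
  s≤s z≤n , 1∣ _ , divides (suc (2 * i)) (eq x i) , 1-coprimeTo _ , ch
  where
  eq : ∀ x i → 1 + 2 * (i * suc (2 * x) + x) ≡ suc (2 * i) * suc (2 * x)
  eq = solve-∀
family⇒Solution (_ ∷ _ ∷ _ ∷ ws) (inj₂ (inj₁ (refl , x , refl , (i , refl) , ch))) =
  s≤s z≤n , m∣m*n (suc x) , divides (2 * suc i) (eq x i)
  , subst (Coprime 2) (odd x i) (coprime-2-odd (i * suc x + x)) , ch
  where
  eq : ∀ x i → 2 + 2 * (i * (2 * suc x) + suc (2 * x)) ≡ 2 * suc i * (2 * suc x)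
  eq = solve-∀
  odd : ∀ x i → suc (2 * (i * suc x + x)) ≡ i * (2 * suc x) + suc (2 * x)
  odd = solve-∀
family⇒Solution (_ ∷ _ ∷ _ ∷ ws) (inj₂ (inj₂ (refl , x , refl , (i , refl) , ch))) =
  s≤s z≤n , m∣m*n (2 * suc x) , divides (suc (2 * i)) (eq x i)
  , subst (Coprime 2) (odd x i) (coprime-2-odd (i * (2 * suc x) + x)) , ch
  where
  eq : ∀ x i → 2 + 2 * (i * (2 * (2 * suc x)) + suc (2 * x)) ≡ suc (2 * i) * (2 * (2 * suc x))
  eq = solve-∀
  odd : ∀ x i → suc (2 * (i * (2 * suc x) + x)) ≡ i * (2 * (2 * suc x)) + suc (2 * x)
  odd = solve-∀

-- From `a ∣ p ∣ a + 2 * q` follows that `a` divides 2q; being coprime to `q`, it divides 2.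
a∈[1,2] : ∀ {p a q} → a ∣ p → p ∣ a + 2 * q → Coprime a q → a ≡ 1 ⊎ a ≡ 2
a∈[1,2] {p} {a} {q} a∣p p∣a+2q cop = cases a a∣2
  where
  a∣2 : a ∣ 2
  a∣2 = coprime-divisor cop (subst (a ∣_) (*-comm 2 q) (∣m+n∣m⇒∣n (∣-trans a∣p p∣a+2q) ∣-refl))
  cases : ∀ a → a ∣ 2 → a ≡ 1 ⊎ a ≡ 2
  cases 0 0∣2 = contradiction (0∣⇒≡0 0∣2) λ ()
  cases 1 _ = inj₁ refl
  cases 2 _ = inj₂ refl
  cases (suc (suc (suc a))) a∣2 = contradiction (∣⇒≤ a∣2) λ { (s≤s (s≤s ())) }

factors-odd : ∀ p d q → 1 + 2 * q ≡ d * p →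
  ∃ λ x → p ≡ suc (2 * x) × ∃ λ i → q ≡ i * suc (2 * x) + x
factors-odd p d q eq with even∨odd d | even∨odd p
... | inj₁ (h , refl) | _ = contradiction (trans (sym (*-assoc 2 h p)) (sym eq)) (even≢odd (h * p) q)
... | inj₂ _ | inj₁ (h , refl) = contradiction (trans (swap d h) (sym eq)) (even≢odd (d * h) q)
  where
  swap : ∀ d h → 2 * (d * h) ≡ d * (2 * h)
  swap = solve-∀
... | inj₂ (i , refl) | inj₂ (x , refl) =
  x , refl , i , *-cancelˡ-≡ q _ 2 (suc-injective (trans eq (expand i x)))
  where
  expand : ∀ i x → suc (2 * i) * suc (2 * x) ≡ suc (2 * (i * suc (2 * x) + x))
  expand = solve-∀

-- The hypothesis is 2 + 2q = d p for `q = suc (2 * y)` and `p = 2 * suc x`, halved. Either `d` is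
-- even, or `d` is odd and `suc x` must be even.
factors-even : ∀ x d y → 2 * suc y ≡ d * suc x →
  (∃ λ i → suc (2 * y) ≡ i * (2 * suc x) + suc (2 * x)) ⊎
  (∃ λ z → suc x ≡ 2 * suc z × ∃ λ i → suc (2 * y) ≡ i * (2 * (2 * suc z)) + suc (2 * z))
factors-even x d y eq with even∨odd d | even∨odd (suc x)
... | inj₁ (zero , refl) | _ = contradiction eq λ ()
... | inj₁ (suc i , refl) | _ = inj₁ (i , suc-injective (trans (lhs y) (trans eq (expand i x))))
  where
  lhs : ∀ y → suc (suc (2 * y)) ≡ 2 * suc y
  lhs = solve-∀
  expand : ∀ i x → 2 * suc i * suc x ≡ suc (i * (2 * suc x) + suc (2 * x))
  expand = solve-∀
... | inj₂ (i , refl) | inj₂ (h , sx≡) =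
  contradiction (trans eq (trans (cong (suc (2 * i) *_) sx≡) (expand i h))) (even≢odd (suc y) (i + h + 2 * i * h))
  where
  expand : ∀ i h → suc (2 * i) * suc (2 * h) ≡ suc (2 * (i + h + 2 * i * h))
  expand = solve-∀
... | inj₂ (i , refl) | inj₁ (suc z , sx≡) =
  inj₂ (z , sx≡ , i ,
    suc-injective (trans (lhs y) (trans eq (trans (cong (suc (2 * i) *_) sx≡) (expand i z)))))
  where
  lhs : ∀ y → suc (suc (2 * y)) ≡ 2 * suc y
  lhs = solve-∀
  expand : ∀ i z → suc (2 * i) * (2 * suc z) ≡ suc (i * (2 * (2 * suc z)) + suc (2 * z))
  expand = solve-∀

Solution⇒family : (r : Labelling (3 + m)) → Solution r → OddPair r ⊎ EvenPair r ⊎ QuadPair r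
Solution⇒family (p ∷ a ∷ q ∷ ws) (0<p , a∣p , p∣a+2q@(divides d eq) , cop , ch) with a∈[1,2] a∣p p∣a+2q cop
... | inj₁ refl = let x , p≡ , i , q≡ = factors-odd p d q eq in inj₁ (refl , x , p≡ , (i , q≡) , ch)
... | inj₂ refl with a∣p | even∨odd q
...   | _ | inj₁ (h , refl) = contradiction (cop (∣-refl , m∣m*n h)) λ ()
...   | divides zero refl | _ = contradiction 0<p λ ()
...   | divides (suc x) refl | inj₂ (y , refl) 
        with factors-even x d y (*-cancelˡ-≡ _ _ 2 (trans (lhs y) (trans eq (rhs d x))))
  where
  lhs : ∀ y → 2 * (2 * suc y) ≡ 2 + 2 * suc (2 * y)
  lhs = solve-∀
  rhs : ∀ d x → d * (suc x * 2) ≡ 2 * (d * suc x)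
  rhs = solve-∀
...     | inj₁ (i , q≡) = inj₂ (inj₁ (refl , x , *-comm (suc x) 2 , (i , q≡) , ch))
...     | inj₂ (z , sx≡ , i , q≡) =
          inj₂ (inj₂ (refl , z , trans (*-comm (suc x) 2) (cong (2 *_) sx≡) , (i , q≡) , ch))

-- For common `p` and `q` the quotient (2 + 2q) / p would be both even and odd.
even-quad-disjoint : {r : Labelling (3 + m)} → EvenPair r → QuadPair r → ⊥
even-quad-disjoint {r = p ∷ _ ∷ q ∷ _} (_ , x , refl , (i , q≡) , _) (_ , z , p≡ , (j , q≡′) , _) =
  even≢odd (suc i) j (*-cancelʳ-≡ _ _ (suc x) (begin-equality
    2 * suc i * suc x ≡⟨ lhs i x ⟩
    suc (i * (2 * suc x) + suc (2 * x)) ≡⟨ cong suc (trans (sym q≡) q≡′) ⟩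
    suc (j * (2 * (2 * suc z)) + suc (2 * z)) ≡⟨ rhs j z ⟩
    suc (2 * j) * (2 * suc z) ≡⟨ cong (suc (2 * j) *_) (*-cancelˡ-≡ _ _ 2 p≡) ⟨
    suc (2 * j) * suc x ∎))
  where
  open ≤-Reasoning
  lhs : ∀ i x → 2 * suc i * suc x ≡ suc (i * (2 * suc x) + suc (2 * x))
  lhs = solve-∀
  rhs : ∀ j z → suc (j * (2 * (2 * suc z)) + suc (2 * z)) ≡ suc (2 * j) * (2 * suc z)
  rhs = solve-∀

odd-disjoint : {r : Labelling (3 + m)} → OddPair r → EvenPair r ⊎ QuadPair r → ⊥
odd-disjoint {r = _ ∷ _ ∷ _ ∷ _} (refl , _) (inj₁ (() , _))
odd-disjoint {r = _ ∷ _ ∷ _ ∷ _} (refl , _) (inj₂ (() , _))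

-- Shortest lengths in the three families

steps-suc : ∀ a b i → suc (steps a b i) ≡ steps (suc a) (suc b) i
steps-suc a b zero    = refl
steps-suc a b (suc i) = steps-suc b (suc a) i

length-+* : Length u v k → ∀ i → Length (u + i * v) v k
length-+* {u} l zero = subst (λ x → Length x _ _) (sym (+-identityʳ u)) l
length-+* {u} {v} {k} l (suc i) =
  subst (λ x → Length x v k) (+-assoc u v (i * v)) (length-+* (length-+ l) i)

-- `steps 0 1 x` is x / 2 rounded up.
length-2 : ∀ x → Length 2 x (steps 0 1 x)
length-2 = length-steps id (s≤s z≤n) (λ i → +-comm 2 i) stop (step (s≤s z≤n) (1∣ _) stop)

odd-s : ∀ x → Length (2 * suc (2 * x)) x (steps 0 1 x)
odd-s x = subst (λ u → Length u x (steps 0 1 x)) (eq x) (length-+* (length-2 x) 4)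
  where
  eq : ∀ x → 2 + 4 * x ≡ 2 * suc (2 * x)
  eq = solve-∀

oddT : ℕ → ℕ
oddT zero    = 1
oddT (suc y) = 2 + steps 0 1 y

-- For x > 0 the chain runs 4x + 2, 3x + 1, 2x, x - 1, ..., where 3x + 1 and 2x are half the sums of
-- their neighbours; and 2x is 2 modulo x - 1.
odd-t : ∀ x → Length (2 * suc (2 * x)) (suc (2 * x) + x) (oddT x)
odd-t zero = step (s≤s z≤n) (1∣ _) stop
odd-t (suc y) =
  step {r = 2 * suc y} (s≤s (m≤m+n (2 * suc y) (suc y))) (divides 2 (eq₁ y))
    (step {r = y} (≤-trans (n<1+n y) (m≤m+n (suc y) (suc y + 0))) (divides 2 (eq₂ y))
      (subst (λ u → Length u y (steps 0 1 y)) (eq₃ y) (length-+* (length-2 y) 2)))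
  where
  eq₁ : ∀ y → 2 * suc (2 * suc y) + 2 * suc y ≡ 2 * (suc (2 * suc y) + suc y)
  eq₁ = solve-∀
  eq₂ : ∀ y → suc (2 * suc y) + suc y + y ≡ 2 * (2 * suc y)
  eq₂ = solve-∀
  eq₃ : ∀ y → 2 + 2 * y ≡ 2 * suc y
  eq₃ = solve-∀

even-s : ∀ x → Length (2 * (2 * suc x)) (suc (2 * x)) (x + 1)
even-s x = subst₂ (λ u v → Length u v (x + 1)) (eq₁ x) (eq₂ x)
  (length-+* (length-progression (s≤s z≤n) (length-2 1) x) 2)
  where
  eq₁ : ∀ x → 2 + 2 * (1 + x * 2) ≡ 2 * (2 * suc x)
  eq₁ = solve-∀
  eq₂ : ∀ x → 1 + x * 2 ≡ suc (2 * x)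
  eq₂ = solve-∀

length-1 : ∀ x → Length 1 x x
length-1 x = subst₂ (Length 1) (*-identityʳ x) (+-identityʳ x) (length-progression (s≤s z≤n) stop x)

-- The chain 4x + 4, 4x + 3, 4x + 2, ... descends by ones, as 4x + 4 is 1 modulo 4x + 3. Hence the
-- sum over every fourth ballot number in the formula.
even-t : ∀ x → Length (2 * (2 * suc x)) (2 * suc x + suc (2 * x)) (3 + x * 4)
even-t x = subst₂ (λ u v → Length u v (3 + x * 4)) (eq₁ x) (eq₂ x) (length-+ (length-1 (3 + x * 4)))
  where
  eq₁ : ∀ x → 1 + (3 + x * 4) ≡ 2 * (2 * suc x)
  eq₁ = solve-∀
  eq₂ : ∀ x → 3 + x * 4 ≡ 2 * suc x + suc (2 * x)
  eq₂ = solve-∀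

length-4 : ∀ x → Length 4 (suc (2 * x)) (steps 1 3 x)
length-4 = length-steps (λ x → suc (2 * x)) (s≤s z≤n) rec
  (step (s≤s z≤n) (1∣ _) stop) (length-+ (length-1 3))
  where
  rec : ∀ x → suc (2 * (2 + x)) ≡ suc (2 * x) + 4
  rec = solve-∀

quad-s : ∀ x → Length (2 * (2 * (2 * suc x))) (suc (2 * x)) (steps 1 3 x)
quad-s x = subst (λ u → Length u (suc (2 * x)) (steps 1 3 x)) (eq x) (length-+* (length-4 x) 4)
  where
  eq : ∀ x → 4 + 4 * suc (2 * x) ≡ 2 * (2 * (2 * suc x))
  eq = solve-∀

quadT : ℕ → ℕ
quadT zero    = 3
quadT (suc y) = 2 + steps 1 3 y

-- For x = y + 1 the chain runs 8y + 16, 6y + 11, 4y + 6, 2y + 1, ..., the middle two being half the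
-- sums of their neighbours; and 4y + 6 is 4 modulo 2y + 1. For x = 0 it is 8, 5, 2, 1.
quad-t : ∀ x → Length (2 * (2 * (2 * suc x))) (2 * (2 * suc x) + suc (2 * x)) (quadT x)
quad-t zero = step {r = 2} (s≤s (s≤s (s≤s z≤n))) (divides 2 refl)
  (step {r = 1} (s≤s (s≤s z≤n)) (divides 3 refl) (length-2 1))
quad-t (suc y) =
  step {r = 4 * y + 6} (subst (4 * y + 6 <_) (eq₀ y) (m<m+n (4 * y + 6) (s≤s z≤n))) (divides 2 (eq₁ y))
    (step {r = suc (2 * y)} (subst (suc (2 * y) <_) (eq₂ y) (m<m+n (suc (2 * y)) (s≤s z≤n))) (divides 2 (eq₃ y))
      (subst (λ u → Length u (suc (2 * y)) (steps 1 3 y)) (eq₄ y) (length-+* (length-4 y) 2)))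
  where
  eq₀ : ∀ y → 4 * y + 6 + suc (4 + 2 * y) ≡ 2 * (2 * suc (suc y)) + suc (2 * suc y)
  eq₀ = solve-∀
  eq₁ : ∀ y → 2 * (2 * (2 * suc (suc y))) + (4 * y + 6) ≡ 2 * (2 * (2 * suc (suc y)) + suc (2 * suc y))
  eq₁ = solve-∀
  eq₂ : ∀ y → suc (2 * y) + suc (4 + 2 * y) ≡ 4 * y + 6
  eq₂ = solve-∀
  eq₃ : ∀ y → 2 * (2 * suc (suc y)) + suc (2 * suc y) + suc (2 * y) ≡ 2 * (4 * y + 6)
  eq₃ = solve-∀
  eq₄ : ∀ y → 4 + 2 * suc (2 * y) ≡ 4 * y + 6
  eq₄ = solve-∀

hasSum-shifted-steps : ∀ n k a b →
  HasSum (λ i → β n (k + steps a b i)) (β (suc n) (suc (k + a)) + β (suc n) (suc (k + b)))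
hasSum-shifted-steps n zero a b = hasSum-steps n a b
hasSum-shifted-steps n (suc k) a b = subst (HasSum _)
  (cong₂ (λ x y → β (suc n) (suc x) + β (suc n) (suc y)) (+-suc k a) (+-suc k b))
  (hasSum-cong (λ i → cong (β n) (trans (cong (k +_) (sym (steps-suc a b i))) (+-suc k _)))
    (hasSum-shifted-steps n k (suc a) (suc b)))

-- The total number of structures

module _ (m R : ℕ) (hasSum-R : HasSum (λ i → β (2 + m) (4 + i * 4)) R) where
  private
    ρ ρ⁺ : ℕ → ℕ
    ρ = β (2 + m)
    ρ⁺ = β (3 + m)

  -- One bracket per family. The terms `ρ 2` and `ρ 4` are the exceptional index 0 of `oddT` and
  -- `quadT`; `R`, the sum over every fourth entry, is kept as a parameter.
  arithTotal : ℕ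
  arithTotal = (ρ⁺ 2 + ρ⁺ 3 + (ρ 2 + (ρ⁺ 4 + ρ⁺ 5))) + ((ρ⁺ 3 + R) + (ρ⁺ 3 + ρ⁺ 5 + (ρ 4 + (ρ⁺ 5 + ρ⁺ 7))))

  count-IsArith : HasCount (IsArith (P2 (suc m))) arithTotal
  count-IsArith =
    count-⇔ (λ r → mk⇔
        (Equivalence.from (isArith⇔Solution r) ∘ family⇒Solution r)
        (Solution⇒family r ∘ Equivalence.to (isArith⇔Solution r)))
      (count-⊎ (λ {r} → odd-disjoint {r = r})
        (count-family m 1 _ _ (steps 0 1) oddT (λ _ → s≤s z≤n)
          (*-cancelˡ-≡ _ _ 2 ∘ suc-injective) odd-s odd-t
          (hasSum-shifted-steps (2 + m) 1 0 1) (cons (hasSum-shifted-steps (2 + m) 3 0 1)))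
        (count-⊎ (λ {r} → even-quad-disjoint {r = r})
          (count-family m 2 _ _ (_+ 1) (λ x → 3 + x * 4) (λ _ → s≤s z≤n)
            (suc-injective ∘ *-cancelˡ-≡ _ _ 2) even-s even-t
            (hasSum-cong (λ x → cong ρ (+-suc x 1)) (hasSum-β (2 + m) 2)) hasSum-R)
          (count-family m 2 _ _ (steps 1 3) quadT (λ _ → s≤s z≤n)
            (suc-injective ∘ *-cancelˡ-≡ _ _ 2 ∘ *-cancelˡ-≡ _ _ 2) quad-s quad-t
            (hasSum-shifted-steps (2 + m) 1 1 3) (cons (hasSum-shifted-steps (2 + m) 3 1 3)))))

-- Binomial form of the ballot numbers

-- The ratio of neighbouring binomials, (k + 1) C(n, k + 1) = (n - k) C(n, k), written without
-- subtraction.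
C-absorption : ∀ n k → suc k * (n C suc k) + k * (n C k) ≡ n * (n C k)
C-absorption zero zero = refl
C-absorption zero (suc k) rewrite k>n⇒nCk≡0 {0} {2 + k} (s≤s z≤n) | k>n⇒nCk≡0 {0} {suc k} (s≤s z≤n) =
  cong₂ _+_ (*-zeroʳ (2 + k)) (*-zeroʳ (suc k))
C-absorption (suc n) zero = trans (+-identityʳ _) (trans (+-identityʳ _)
  (trans (nC1≡n (suc n)) (sym (*-identityʳ (suc n)))))
C-absorption (suc n) (suc k)
  rewrite sym (nCk+nC[k+1]≡[n+1]C[k+1] n (suc k)) | sym (nCk+nC[k+1]≡[n+1]C[k+1] n k) =
  begin
    suc (suc k) * (y + z) + suc k * (x + y)
      ≡⟨ regroup k x y z ⟩
    (suc (suc k) * z + suc k * y) + (suc k * y + k * x) + (x + y)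
      ≡⟨ cong₂ (λ p q → p + q + (x + y)) (C-absorption n (suc k)) (C-absorption n k) ⟩
    n * y + n * x + (x + y)
      ≡⟨ collect n x y ⟩
    suc n * (x + y) ∎
  where
  open ≡-Reasoning
  x = n C k
  y = n C suc k
  z = n C suc (suc k)
  regroup : ∀ k x y z → suc (suc k) * (y + z) + suc k * (x + y)
                      ≡ (suc (suc k) * z + suc k * y) + (suc k * y + k * x) + (x + y)
  regroup = solve-∀
  collect : ∀ n x y → n * y + n * x + (x + y) ≡ suc n * (x + y)
  collect = solve-∀

β-diagonal : ∀ n → β n n ≡ 1
β-diagonal zero    = refl
β-diagonal (suc n) = trans (β-suc n n)
  (trans (cong (β n n +_) (β-vanishes (n<1+n (suc n)))) (trans (+-identityʳ _) (β-diagonal n)))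

-- The reflection formula with N = 2n - k: `β-suc` matches Pascal's rule. The induction runs on the
-- distance `m` from the diagonal, then on `k`.
β-C : ∀ m k {n N} → n ≡ m + k → N ≡ m + n → β (suc n) (suc k) + N C suc n ≡ N C n
β-C zero k refl refl = trans (cong₂ _+_ (β-diagonal (suc k)) (k>n⇒nCk≡0 (n<1+n k))) (sym (nCn≡1 k))
β-C (suc m) zero {suc n} {suc N} n≡ N≡ = begin
  β (2 + n) 1 + suc N C (2 + n)            ≡⟨ cong₂ _+_ (β-suc (suc n) 0) (sym (nCk+nC[k+1]≡[n+1]C[k+1] N (suc n))) ⟩
  β (2 + n) 2 + (N C suc n + N C (2 + n))  ≡⟨ swap (β (2 + n) 2) (N C suc n) _ ⟩
  N C suc n + (β (2 + n) 2 + N C (2 + n))  ≡⟨ cong (N C suc n +_) (β-C m 1 (trans n≡ (sym (+-suc m 0))) N≡′) ⟩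
  N C suc n + N C suc n                    ≡⟨ cong (_+ N C suc n) symm ⟨
  N C n + N C suc n                        ≡⟨ nCk+nC[k+1]≡[n+1]C[k+1] N n ⟩
  suc N C suc n                            ∎
  where
  open ≡-Reasoning
  N≡′ : N ≡ m + suc n
  N≡′ = suc-injective N≡
  n≡m : n ≡ m
  n≡m = trans (suc-injective n≡) (+-identityʳ m)
  N≡n+sn : N ≡ n + suc n
  N≡n+sn = trans N≡′ (cong (_+ suc n) (sym n≡m))
  symm : N C n ≡ N C suc n
  -- At k = 0 the left neighbour in the triangle is 0; now N = 2n + 1, so the two middle binomials
  -- agree.
  symm = trans (nCk≡nC[n∸k] (subst (n ≤_) (sym N≡n+sn) (m≤m+n n (suc n))))
               (cong (N C_) (trans (cong (_∸ n) N≡n+sn) (m+n∸m≡n n (suc n))))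
  swap : ∀ x y z → x + (y + z) ≡ y + (x + z)
  swap = solve-∀
β-C (suc m) (suc k) {suc n} {suc N} n≡ N≡ = begin
  β (2 + n) (2 + k) + suc N C (2 + n)
    ≡⟨ cong₂ _+_ (β-suc (suc n) (suc k)) (sym (nCk+nC[k+1]≡[n+1]C[k+1] N (suc n))) ⟩
  β (1 + n) (1 + k) + β (2 + n) (3 + k) + (N C suc n + N C (2 + n))
    ≡⟨ interchange (β (1 + n) (1 + k)) (β (2 + n) (3 + k)) _ _ ⟩
  (β (1 + n) (1 + k) + N C suc n) + (β (2 + n) (3 + k) + N C (2 + n))
    ≡⟨ cong₂ _+_ (β-C (suc m) k n≡₁ (trans (suc-injective N≡) (+-suc m n)))
                 (β-C m (2 + k) (trans n≡ (sym (+-suc m (suc k)))) (suc-injective N≡)) ⟩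
  N C n + N C suc n
    ≡⟨ nCk+nC[k+1]≡[n+1]C[k+1] N n ⟩
  suc N C suc n ∎
  where
  open ≡-Reasoning
  n≡₁ : n ≡ suc m + k
  n≡₁ = trans (suc-injective n≡) (+-suc m k)
  interchange : ∀ x y z w → x + y + (z + w) ≡ x + z + (y + w)
  interchange = solve-∀

-- `β-C` times `suc n`, where absorption turns (n + 1) C(N, n + 1) into m C(N, n). This shows that
-- the divisions in `ballot` and `catalan` are exact.
suc-*-β : ∀ m k {n N} → n ≡ m + k → N ≡ m + n → suc n * β (suc n) (suc k) ≡ suc k * (N C n)
suc-*-β m k {n} {N} refl refl = +-cancelʳ-≡ (m * y) _ _ (begin
  suc n * x + m * y              ≡⟨ cong (suc n * x +_) (sym absorbed) ⟩
  suc n * x + suc n * (N C suc n) ≡⟨ *-distribˡ-+ (suc n) x _ ⟨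
  suc n * (x + N C suc n)        ≡⟨ cong (suc n *_) (β-C m k refl refl) ⟩
  suc (m + k) * y                ≡⟨ split m k y ⟩
  suc k * y + m * y              ∎)
  where
  open ≡-Reasoning
  x = β (suc n) (suc k)
  y = N C n
  absorbed : suc n * (N C suc n) ≡ m * y
  absorbed = +-cancelʳ-≡ (n * y) _ _ (trans (C-absorption N n) (*-distribʳ-+ y m n))
  split : ∀ m k y → suc (m + k) * y ≡ suc k * y + m * y
  split = solve-∀

ballot≡β : ∀ {k n} → k ≤ n → ballot (suc n) (suc k) ≡ β (suc n) (suc k)
ballot≡β {k} {n} k≤n = begin
  (suc k * ((2 * suc n ∸ suc k ∸ 1) C n)) / suc n ≡⟨ cong (λ N → (suc k * (N C n)) / suc n) top ⟩
  (suc k * ((d + n) C n)) / suc n ≡⟨ cong (_/ suc n) (suc-*-β d k (sym (m∸n+n≡m k≤n)) refl) ⟨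
  (suc n * β (suc n) (suc k)) / suc n ≡⟨ cong (_/ suc n) (*-comm (suc n) (β (suc n) (suc k))) ⟩
  (β (suc n) (suc k) * suc n) / suc n ≡⟨ m*n/n≡m (β (suc n) (suc k)) (suc n) ⟩
  β (suc n) (suc k) ∎
  where
  open ≡-Reasoning
  d = n ∸ k
  double : ∀ k m n → n ≡ m + k → 2 * suc n ≡ suc k + 1 + (m + n)
  double k m n refl = solve k m
    where
    solve : ∀ k m → 2 * suc (m + k) ≡ suc k + 1 + (m + (m + k))
    solve = solve-∀
  top : 2 * suc n ∸ suc k ∸ 1 ≡ d + n
  top = trans (∸-+-assoc (2 * suc n) (suc k) 1)
    (trans (cong (_∸ (suc k + 1)) (double k d n (sym (m∸n+n≡m k≤n)))) (m+n∸m≡n (suc k + 1) (d + n)))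

suc-*-β₁ : ∀ n → suc n * β (suc n) 1 ≡ (2 * n) C n
suc-*-β₁ n = trans (suc-*-β n 0 (sym (+-identityʳ n)) (cong (n +_) (+-identityʳ n))) (*-identityˡ _)

catalan≡β : ∀ n → catalan n ≡ β (suc n) 1
catalan≡β n = begin
  ((2 * n) C n) / suc n ≡⟨ cong (_/ suc n) (suc-*-β₁ n) ⟨
  (suc n * β (suc n) 1) / suc n ≡⟨ cong (_/ suc n) (*-comm (suc n) (β (suc n) 1)) ⟩
  (β (suc n) 1 * suc n) / suc n ≡⟨ m*n/n≡m (β (suc n) 1) (suc n) ⟩
  β (suc n) 1 ∎
  where open ≡-Reasoning

-- Both sides times `suc n` become central binomials; Pascal's rule, symmetry and absorption relate
-- C(2n + 2, n + 1) to C(2n, n).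
catalan-suc : ∀ n → (2 + n) * β (2 + n) 1 ≡ (2 + 4 * n) * β (suc n) 1
catalan-suc n = *-cancelˡ-≡ _ _ (suc n) (begin
  suc n * ((2 + n) * β (2 + n) 1) ≡⟨ cong (suc n *_) (suc-*-β₁ (suc n)) ⟩
  suc n * ((2 * suc n) C suc n)   ≡⟨ cong (λ N → suc n * (suc N C suc n)) (+-suc n (n + 0)) ⟩
  suc n * (suc (suc (2 * n)) C suc n)
    ≡⟨ cong (suc n *_) (sym (nCk+nC[k+1]≡[n+1]C[k+1] (suc (2 * n)) n)) ⟩
  suc n * (suc (2 * n) C n + suc (2 * n) C suc n)
    ≡⟨ cong (λ x → suc n * (x + suc (2 * n) C suc n)) symm ⟩
  suc n * (suc (2 * n) C suc n + suc (2 * n) C suc n)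
    ≡⟨ cong (λ x → suc n * (x + x)) (sym (nCk+nC[k+1]≡[n+1]C[k+1] (2 * n) n)) ⟩
  suc n * (y + z + (y + z))
    ≡⟨ regroup n y z ⟩
  2 * ((suc n * z + n * y) + y)
    ≡⟨ cong (λ x → 2 * (x + y)) (C-absorption (2 * n) n) ⟩
  2 * (2 * n * y + y)
    ≡⟨ cong (λ x → 2 * (2 * n * x + x)) (suc-*-β₁ n) ⟨
  2 * (2 * n * (suc n * β (suc n) 1) + suc n * β (suc n) 1)
    ≡⟨ collect n (β (suc n) 1) ⟩
  suc n * ((2 + 4 * n) * β (suc n) 1) ∎)
  where
  open ≡-Reasoning
  y = (2 * n) C n
  z = (2 * n) C suc n
  regroup : ∀ n y z → suc n * (y + z + (y + z)) ≡ 2 * ((suc n * z + n * y) + y)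
  regroup = solve-∀
  collect : ∀ n x → 2 * (2 * n * (suc n * x) + suc n * x) ≡ suc n * ((2 + 4 * n) * x)
  collect = solve-∀
  symm : suc (2 * n) C n ≡ suc (2 * n) C suc n
  symm = trans (nCk≡nC[n∸k] (m≤n⇒m≤1+n (m≤m+n n (n + 0))))
    (cong (suc (2 * n) C_) (trans
      (cong (_∸ n) (trans (sym (+-suc n (n + 0))) (cong (λ x → n + suc x) (+-identityʳ n))))
      (m+n∸m≡n n (suc n))))

hasSum-prefix : ∀ K → (∀ {i} → i < K → g i ≡ f i) → (∀ {i} → K ≤ i → f i ≡ 0) →
                HasSum f (sum (applyUpTo g K))
hasSum-prefix zero    g≗f f≗0 = zeros λ _ → f≗0 z≤n
hasSum-prefix {g} {f} (suc K) g≗f f≗0 =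
  subst (λ x → HasSum f (x + sum (applyUpTo (g ∘ suc) K))) (sym (g≗f (s≤s z≤n)))
    (cons (hasSum-prefix K (g≗f ∘ s≤s) (f≗0 ∘ s≤s)))

ballotSum : ℕ → ℕ
ballotSum n = sum (map (λ i → ballot (suc n) (4 * (2 + i))) (upTo ((suc n / 4) ∸ 1)))

-- The sum in the formula starts at j = 2, so the entry for j = 1 is split off. Its upper limit is
-- where the row ends.
hasSum-ballotSum : ∀ n → HasSum (λ i → β (suc n) (4 + i * 4)) (β (suc n) 4 + ballotSum n)
hasSum-ballotSum n = cons (subst (HasSum _) (cong sum (sym (map-upTo _ K)))
  (hasSum-prefix K agree vanish))
  where
  K = (suc n / 4) ∸ 1
  agree : ∀ {i} → i < K → ballot (suc n) (4 * (2 + i)) ≡ β (suc n) (4 + (suc i) * 4)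
  agree {i} i<K = trans (cong (ballot (suc n)) (*-comm 4 (2 + i))) (ballot≡β (s≤s⁻¹ bound))
    where
    bound : (2 + i) * 4 ≤ suc n
    bound = ≤-trans (*-monoˡ-≤ 4 (lemma (suc n / 4) i<K)) (m/n*n≤m (suc n) 4)
      where
      lemma : ∀ q → i < q ∸ 1 → 2 + i ≤ q
      lemma (suc q) i<q = s≤s i<q
  vanish : ∀ {i} → K ≤ i → β (suc n) (4 + (suc i) * 4) ≡ 0
  vanish {i} K≤i = β-vanishes (<-≤-trans below
    (*-monoˡ-≤ 4 (s≤s (≤-trans (m≤n+m∸n (suc n / 4) 1) (s≤s K≤i)))))
    where
    below : suc n < suc (suc n / 4) * 4
    below = subst (_< suc (suc n / 4) * 4) (sym (m≡m%n+[m/n]*n (suc n) 4))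
      (+-monoˡ-< (suc n / 4 * 4) (m%n<n (suc n) 4))

-- tₖ, bₖ, aₖ are the entries of three consecutive rows, the lowest row first, and `z` is the first
-- entry of the row above. The triangle rule reduces all of them to `t₇`, `b₅`, `a₃`, `z`.
eliminate : ∀ {t₁ t₂ t₃ t₄ t₅ t₆ t₇ b₁ b₂ b₃ b₄ b₅ a₁ a₂ a₃ z} R →
  t₁ ≡ t₂ → t₂ ≡ b₁ + t₃ → t₃ ≡ b₂ + t₄ → t₄ ≡ b₃ + t₅ → t₅ ≡ b₄ + t₆ → t₆ ≡ b₅ + t₇ →
  b₁ ≡ b₂ → b₂ ≡ a₁ + b₃ → b₃ ≡ a₂ + b₄ → b₄ ≡ a₃ + b₅ →
  a₁ ≡ a₂ → a₂ ≡ z + a₃ →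
  (t₂ + t₃ + (b₂ + (t₄ + t₅))) + ((t₃ + R) + (t₃ + t₅ + (b₄ + (t₅ + t₇)))) + 17 * b₁ + z ≡
  9 * t₁ + 7 * a₁ + R
eliminate {t₇ = t} {b₅ = b} {a₃ = a} {z} R refl refl refl refl refl refl refl refl refl refl refl refl =
  identity t b a z R
  where
  identity : ∀ t b a z R →
    let a₂ = z + a ; b₄ = a + b ; b₃ = a₂ + b₄ ; b₂ = a₂ + b₃
        t₆ = b + t ; t₅ = b₄ + t₆ ; t₄ = b₃ + t₅ ; t₃ = b₂ + t₄ ; t₂ = b₂ + t₃ in
    (t₂ + t₃ + (b₂ + (t₄ + t₅))) + ((t₃ + R) + (t₃ + t₅ + (b₄ + (t₅ + t)))) + 17 * b₂ + z ≡
    9 * t₂ + 7 * a₂ + R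
  identity = solve-∀

arithTotal-catalan : ∀ l R s → arithTotal (suc l) R s + 17 * β (3 + l) 1 + β (1 + l) 1
                             ≡ 9 * β (4 + l) 1 + 7 * β (2 + l) 1 + R
arithTotal-catalan l R s = eliminate R
  (β-suc (3 + l) 0) (β-suc (3 + l) 1) (β-suc (3 + l) 2) (β-suc (3 + l) 3) (β-suc (3 + l) 4)
  (β-suc (3 + l) 5)
  (β-suc (2 + l) 0) (β-suc (2 + l) 1) (β-suc (2 + l) 2) (β-suc (2 + l) 3)
  (β-suc (1 + l) 0) (β-suc (1 + l) 1)

-- The formula

open import Data.Integer.Base as ℤ using (+_)
import Data.Integer.Properties as ℤ
import Data.Integer.Tactic.RingSolver as ℤ-Solver
open import Data.Rational.Base as ℚ using (ℚ; mkℚ; 0ℚ)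
import Data.Rational.Properties as ℚ
open import Data.Rational.Unnormalised.Base as ℚᵘ using (mkℚᵘ; *<*)
import Data.Rational.Unnormalised.Properties as ℚᵘ

-- The term j = 1 of the sum is C_n - 2 C_{n-1}; it changes the coefficients -17 and 7 into -16 and
-- 5.
β-4 : ∀ l → β (3 + l) 1 ≡ 2 * β (2 + l) 1 + β (3 + l) 4
β-4 l = begin
  β (3 + l) 1                                 ≡⟨ β-suc (2 + l) 0 ⟩
  β (3 + l) 2                                 ≡⟨ β-suc (2 + l) 1 ⟩
  β (2 + l) 1 + β (3 + l) 3                   ≡⟨ cong (λ x → β (2 + l) 1 + x) (β-suc (2 + l) 2) ⟩
  β (2 + l) 1 + (β (2 + l) 2 + β (3 + l) 4)   ≡⟨ cong (λ x → β (2 + l) 1 + (x + β (3 + l) 4)) (β-suc (1 + l) 0) ⟨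
  β (2 + l) 1 + (β (2 + l) 1 + β (3 + l) 4)   ≡⟨ collect (β (2 + l) 1) (β (3 + l) 4) ⟩
  2 * β (2 + l) 1 + β (3 + l) 4               ∎
  where
  open ≡-Reasoning
  collect : ∀ x y → x + (x + y) ≡ 2 * x + y
  collect = solve-∀

formula-ℤ : ∀ N t b a z S → N + 16 * b + z ≡ 9 * t + 5 * a + S →
  + N ≡ ((((+ (9 * t) ℤ.- + (16 * b)) ℤ.+ + (5 * a)) ℤ.- + z) ℤ.+ + S)
formula-ℤ N t b a z S eq = begin
  + N                                      ≡⟨ cancel (+ N) (+ (16 * b)) (+ z) ⟩
  + (N + 16 * b + z) ℤ.- (+ (16 * b) ℤ.+ + z) ≡⟨ cong (λ x → + x ℤ.- (+ (16 * b) ℤ.+ + z)) eq ⟩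
  + (9 * t + 5 * a + S) ℤ.- (+ (16 * b) ℤ.+ + z)
    ≡⟨ rearrange (+ (9 * t)) (+ (5 * a)) (+ S) (+ (16 * b)) (+ z) ⟩
  ((((+ (9 * t) ℤ.- + (16 * b)) ℤ.+ + (5 * a)) ℤ.- + z) ℤ.+ + S) ∎
  where
  open ≡-Reasoning
  cancel : ∀ x y z → x ≡ (x ℤ.+ y ℤ.+ z) ℤ.- (y ℤ.+ z)
  cancel = ℤ-Solver.solve-∀
  rearrange : ∀ t a s b z → (t ℤ.+ a ℤ.+ s) ℤ.- (b ℤ.+ z) ≡ ((((t ℤ.- b) ℤ.+ a) ℤ.- z) ℤ.+ s)
  rearrange = ℤ-Solver.solve-∀

arithCount : ℕ → ℕ
arithCount l = arithTotal (suc l) _ (hasSum-ballotSum (2 + l))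

count-arithCount : ∀ l → HasCount (IsArith (P2 (2 + l))) (arithCount l)
count-arithCount l = count-IsArith (suc l) _ (hasSum-ballotSum (2 + l))

arithCount≡formula : ∀ l → + arithCount l ≡ arithFormula (2 + l)
arithCount≡formula l
  rewrite catalan≡β (3 + l) | catalan≡β (2 + l) | catalan≡β (1 + l) | catalan≡β l =
  formula-ℤ (arithCount l) t b a z (ballotSum (2 + l)) (+-cancelʳ-≡ b _ _ (begin
    arithCount l + 16 * b + z + b                         ≡⟨ lhs (arithCount l) b z ⟩
    arithCount l + 17 * b + z                             ≡⟨ arithTotal-catalan l _ (hasSum-ballotSum (2 + l)) ⟩
    9 * t + 7 * a + (β (3 + l) 4 + ballotSum (2 + l))     ≡⟨ rhs t a (β (3 + l) 4) (ballotSum (2 + l)) ⟩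
    9 * t + 5 * a + ballotSum (2 + l) + (2 * a + β (3 + l) 4)
      ≡⟨ cong (λ x → 9 * t + 5 * a + ballotSum (2 + l) + x) (β-4 l) ⟨
    9 * t + 5 * a + ballotSum (2 + l) + b ∎))
  where
  open ≡-Reasoning
  t = β (4 + l) 1
  b = β (3 + l) 1
  a = β (2 + l) 1
  z = β (1 + l) 1
  lhs : ∀ N b z → N + 16 * b + z + b ≡ N + 17 * b + z
  lhs = solve-∀
  rhs : ∀ t a x s → 9 * t + 7 * a + (x + s) ≡ 9 * t + 5 * a + s + (2 * a + x)
  rhs = solve-∀

-- Asymptotics

-- The sum over i, i + 4, i + 8, ..., with `i` not reduced modulo 4; `suc n` terms go beyond the
-- support of the row.
residueSum : ℕ → ℕ → ℕ
residueSum n i = sum (applyUpTo (λ j → β n (i + j * 4)) (suc n))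

hasSum-residue : ∀ n i → HasSum (λ j → β n (i + j * 4)) (residueSum n i)
hasSum-residue n i = hasSum-prefix (suc n) (λ _ → refl)
  λ {j} n<j → β-vanishes (<-≤-trans n<j (≤-trans (m≤m*n j 4) (m≤n+m (j * 4) i)))

residueSum-suc : ∀ n i → residueSum (suc n) (suc i) ≡ residueSum n i + residueSum (suc n) (2 + i)
residueSum-suc n i = hasSum-unique (hasSum-residue (suc n) (suc i))
  (hasSum-cong (λ j → sym (β-suc n (i + j * 4)))
    (hasSum-+ (hasSum-residue n i) (hasSum-residue (suc n) (2 + i))))

residueSum-4 : ∀ n i → residueSum n i ≡ β n i + residueSum n (4 + i)
residueSum-4 n i = hasSum-unique (hasSum-residue n i)
  (subst (λ z → HasSum (λ j → β n (i + j * 4)) (z + residueSum n (4 + i))) (cong (β n) (+-identityʳ i))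
    (cons (hasSum-cong (λ j → cong (β n) (shift i (j * 4))) (hasSum-residue n (4 + i)))))
  where
  shift : ∀ i x → 4 + i + x ≡ i + (4 + x)
  shift = solve-∀

-- Four uses of `residueSum-suc` telescope to s⁺ 1 - s⁺ 5, which is the single entry `β (suc n) 1`.
residueSum-total : ∀ n → residueSum n 0 + residueSum n 1 + residueSum n 2 + residueSum n 3 ≡ β (suc n) 1
residueSum-total n = +-cancelʳ-≡ (residueSum (suc n) 5) _ _ (begin
  s 0 + s 1 + s 2 + s 3 + s⁺ 5      ≡⟨ assoc (s 0) (s 1) (s 2) (s 3) (s⁺ 5) ⟩
  s 0 + (s 1 + (s 2 + (s 3 + s⁺ 5))) ≡⟨ cong (λ x → s 0 + (s 1 + (s 2 + x))) (residueSum-suc n 3) ⟨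
  s 0 + (s 1 + (s 2 + s⁺ 4))        ≡⟨ cong (λ x → s 0 + (s 1 + x)) (residueSum-suc n 2) ⟨
  s 0 + (s 1 + s⁺ 3)                ≡⟨ cong (λ x → s 0 + x) (residueSum-suc n 1) ⟨
  s 0 + s⁺ 2                        ≡⟨ residueSum-suc n 0 ⟨
  s⁺ 1                              ≡⟨ residueSum-4 (suc n) 1 ⟩
  β (suc n) 1 + s⁺ 5                ∎)
  where
  open ≡-Reasoning
  s s⁺ : ℕ → ℕ
  s  = residueSum n
  s⁺ = residueSum (suc n)
  assoc : ∀ a b c d e → a + b + c + d + e ≡ a + (b + (c + (d + e)))
  assoc = solve-∀

-- Bounds for the error terms

cat : ℕ → ℕ
cat n = β (suc n) 1

gap : ℕ → ℤ.ℤ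
gap n = + cat (suc n) ℤ.- + 4 ℤ.* + cat n

-- By the Catalan recursion, (4n + 2) - 4 (n + 2) = -6.
∣gap∣ : ∀ n → (2 + n) * ℤ.∣ gap n ∣ ≡ 6 * cat n
∣gap∣ n = begin
  (2 + n) * ℤ.∣ gap n ∣                  ≡⟨ ℤ.abs-* (+ (2 + n)) (gap n) ⟨
  ℤ.∣ + (2 + n) ℤ.* gap n ∣              ≡⟨ cong ℤ.∣_∣ signed ⟩
  ℤ.∣ ℤ.- (+ 6 ℤ.* + cat n) ∣            ≡⟨ ℤ.∣-i∣≡∣i∣ (+ 6 ℤ.* + cat n) ⟩
  ℤ.∣ + 6 ℤ.* + cat n ∣                  ≡⟨ ℤ.abs-* (+ 6) (+ cat n) ⟩
  6 * cat n                              ∎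
  where
  open ≡-Reasoning
  distribute : ∀ k x y → k ℤ.* (x ℤ.- + 4 ℤ.* y) ≡ k ℤ.* x ℤ.- + 4 ℤ.* (k ℤ.* y)
  distribute = ℤ-Solver.solve-∀
  collect : ∀ n y → (+ 2 ℤ.+ + 4 ℤ.* n) ℤ.* y ℤ.- + 4 ℤ.* ((+ 2 ℤ.+ n) ℤ.* y) ≡ ℤ.- (+ 6 ℤ.* y)
  collect = ℤ-Solver.solve-∀
  signed : + (2 + n) ℤ.* gap n ≡ ℤ.- (+ 6 ℤ.* + cat n)
  signed = trans (distribute (+ (2 + n)) (+ cat (suc n)) (+ cat n))
    (trans (cong (λ z → z ℤ.- + 4 ℤ.* (+ (2 + n) ℤ.* + cat n)) (begin
       + (2 + n) ℤ.* + cat (suc n)   ≡⟨ ℤ.pos-* (2 + n) (cat (suc n)) ⟨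
       + ((2 + n) * cat (suc n))     ≡⟨ cong +_ (catalan-suc n) ⟩
       + ((2 + 4 * n) * cat n)       ≡⟨ ℤ.pos-* (2 + 4 * n) (cat n) ⟩
       + (2 + 4 * n) ℤ.* + cat n     ≡⟨ cong (λ z → (+ 2 ℤ.+ z) ℤ.* + cat n) (ℤ.pos-* 4 n) ⟩
       (+ 2 ℤ.+ + 4 ℤ.* + n) ℤ.* + cat n ∎))
     (collect (+ n) (+ cat n)))

row : (ℤ.ℤ → ℤ.ℤ → ℤ.ℤ → ℤ.ℤ → ℤ.ℤ → ℤ.ℤ) → ℕ → ℤ.ℤ
row e n = e (+ cat n) (+ residueSum n 0) (+ residueSum n 1) (+ residueSum n 2) (+ residueSum n 3)

cat-residues : ∀ n → + cat n ≡ + residueSum n 0 ℤ.+ + residueSum n 1 ℤ.+ + residueSum n 2 ℤ.+ + residueSum n 3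
cat-residues n = cong +_ (sym (residueSum-total n))

row-recurrences : ∀ n →
  + 2 ℤ.* row Errors.e₁ (suc n) ≡ ℤ.- row Errors.e₁ n ℤ.+ + 2 ℤ.* gap n ×
  + 2 ℤ.* row Errors.e₂ (suc n) ≡ row Errors.e₂ n ℤ.- row Errors.e₃ n ℤ.+ + 8 ℤ.* gap n ×
  + 2 ℤ.* row Errors.e₃ (suc n) ≡ row Errors.e₂ n ℤ.+ row Errors.e₃ n ℤ.- + 6 ℤ.* gap n
row-recurrences n = Errors.recurrences _ _
  (+ residueSum n 0) (+ residueSum n 1) (+ residueSum n 2) (+ residueSum n 3)
  (+ residueSum (suc n) 0) (+ residueSum (suc n) 1) (+ residueSum (suc n) 2) (+ residueSum (suc n) 3)
  (cat-residues n) (cat-residues (suc n))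
  (cong +_ (residueSum-suc n 0)) (cong +_ (residueSum-suc n 1))
  -- The residues close up into a cycle: starting at 4 or at 0 gives the same sum, as `β (suc n) 0`
  -- is 0.
  (cong +_ (trans (residueSum-suc n 2) (cong (λ x → residueSum n 2 + x) (sym (residueSum-4 (suc n) 0)))))

-- Multiplying by 2n(n+2), the claim becomes 40(n+1)(n+2) + 48n(n+1) ≤ 40n(4n+2).
contraction : ∀ k C C′ e x y d → let n = 2 + k in
  2 * e ≤ x + y + 8 * d → n * x ≤ 20 * C → n * y ≤ 20 * C →
  (2 + n) * d ≡ 6 * C → (2 + n) * C′ ≡ (2 + 4 * n) * C → (1 + n) * e ≤ 20 * C′
contraction k C C′ e x y d 2e≤ nx≤ ny≤ d≡ C′≡ =
  *-cancelˡ-≤ (2 * (n * (2 + n))) (begin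
    2 * (n * (2 + n)) * ((1 + n) * e)
      ≡⟨ lhs n e ⟩
    (n * (1 + n) * (2 + n)) * (2 * e)
      ≤⟨ *-monoʳ-≤ (n * (1 + n) * (2 + n)) 2e≤ ⟩
    (n * (1 + n) * (2 + n)) * (x + y + 8 * d)
      ≡⟨ expand n x y d ⟩
    (1 + n) * (2 + n) * (n * x + n * y) + 8 * n * (1 + n) * ((2 + n) * d)
      ≡⟨ cong (λ z → (1 + n) * (2 + n) * (n * x + n * y) + 8 * n * (1 + n) * z) d≡ ⟩
    (1 + n) * (2 + n) * (n * x + n * y) + 8 * n * (1 + n) * (6 * C)
      ≤⟨ +-monoˡ-≤ (8 * n * (1 + n) * (6 * C)) (*-monoʳ-≤ ((1 + n) * (2 + n)) (+-mono-≤ nx≤ ny≤)) ⟩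
    (1 + n) * (2 + n) * (20 * C + 20 * C) + 8 * n * (1 + n) * (6 * C)
      -- The slack is 72n² - 88n - 80 at n = 2 + k. It is negative at n = 1, hence the induction
      -- from n = 2.
      ≤⟨ m≤m+n _ ((32 + 200 * k + 72 * k * k) * C) ⟩
    (1 + n) * (2 + n) * (20 * C + 20 * C) + 8 * n * (1 + n) * (6 * C) + (32 + 200 * k + 72 * k * k) * C
      ≡⟨ slack k C ⟩
    40 * n * ((2 + 4 * n) * C)
      ≡⟨ cong (λ z → 40 * n * z) C′≡ ⟨
    40 * n * ((2 + n) * C′)
      ≡⟨ rhs n C′ ⟩
    2 * (n * (2 + n)) * (20 * C′) ∎)
  where
  open ≤-Reasoning
  n = 2 + k
  lhs : ∀ n e → 2 * (n * (2 + n)) * ((1 + n) * e) ≡ (n * (1 + n) * (2 + n)) * (2 * e)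
  lhs = solve-∀
  expand : ∀ n x y d → (n * (1 + n) * (2 + n)) * (x + y + 8 * d)
                     ≡ (1 + n) * (2 + n) * (n * x + n * y) + 8 * n * (1 + n) * ((2 + n) * d)
  expand = solve-∀
  slack : ∀ k C → let n = 2 + k in
    (1 + n) * (2 + n) * (20 * C + 20 * C) + 8 * n * (1 + n) * (6 * C) + (32 + 200 * k + 72 * k * k) * C
    ≡ 40 * n * ((2 + 4 * n) * C)
  slack = solve-∀
  rhs : ∀ n z → 40 * n * ((2 + n) * z) ≡ 2 * (n * (2 + n)) * (20 * z)
  rhs = solve-∀

-- The constant 20 fits the base n = 2, where C_2 = 2 and the errors are 2, -17 and 19.
Bounded : ℕ → ℤ.ℤ → Set
Bounded n e = n * ℤ.∣ e ∣ ≤ 20 * cat n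

bounded-suc : ∀ k e i j c → c ≤ 8 → let n = 2 + k in
  ℤ.∣ + 2 ℤ.* e ∣ ≤ ℤ.∣ i ∣ + ℤ.∣ j ∣ + ℤ.∣ + c ℤ.* gap n ∣ →
  Bounded n i → Bounded n j → Bounded (suc n) e
bounded-suc k e i j c c≤8 2e≤ bi bj =
  contraction k (cat n) (cat (suc n)) ℤ.∣ e ∣ ℤ.∣ i ∣ ℤ.∣ j ∣ ℤ.∣ gap n ∣
    (begin
      2 * ℤ.∣ e ∣                                     ≡⟨ ℤ.abs-* (+ 2) e ⟨
      ℤ.∣ + 2 ℤ.* e ∣                                 ≤⟨ 2e≤ ⟩
      ℤ.∣ i ∣ + ℤ.∣ j ∣ + ℤ.∣ + c ℤ.* gap n ∣         ≡⟨ cong (λ z → ℤ.∣ i ∣ + ℤ.∣ j ∣ + z) (ℤ.abs-* (+ c) (gap n)) ⟩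
      ℤ.∣ i ∣ + ℤ.∣ j ∣ + c * ℤ.∣ gap n ∣             ≤⟨ +-monoʳ-≤ (ℤ.∣ i ∣ + ℤ.∣ j ∣) (*-monoˡ-≤ ℤ.∣ gap n ∣ c≤8) ⟩
      ℤ.∣ i ∣ + ℤ.∣ j ∣ + 8 * ℤ.∣ gap n ∣             ∎)
    bi bj (∣gap∣ n) (catalan-suc n)
  where
  open ≤-Reasoning
  n = 2 + k

rows-bounded : ∀ k → let n = 2 + k in
  Bounded n (row Errors.e₁ n) × Bounded n (row Errors.e₂ n) × Bounded n (row Errors.e₃ n)
rows-bounded zero = ≤ᵇ⇒≤ _ _ tt , ≤ᵇ⇒≤ _ _ tt , ≤ᵇ⇒≤ _ _ tt
rows-bounded (suc k) =
  let b₁ , b₂ , b₃ = rows-bounded k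
      eq₁ , eq₂ , eq₃ = row-recurrences n in
  -- The recurrence of e₁ involves no other error, so 0 fills the second place.
  bounded-suc k (row Errors.e₁ (suc n)) e₁ (+ 0) 2 (from-yes (2 ≤? 8))
    (begin
      ℤ.∣ + 2 ℤ.* row Errors.e₁ (suc n) ∣          ≡⟨ cong ℤ.∣_∣ eq₁ ⟩
      ℤ.∣ ℤ.- e₁ ℤ.+ + 2 ℤ.* gap n ∣               ≤⟨ ℤ.∣i+j∣≤∣i∣+∣j∣ (ℤ.- e₁) (+ 2 ℤ.* gap n) ⟩
      ℤ.∣ ℤ.- e₁ ∣ + ℤ.∣ + 2 ℤ.* gap n ∣           ≡⟨ cong (λ z → z + ℤ.∣ + 2 ℤ.* gap n ∣)
                                                       (trans (ℤ.∣-i∣≡∣i∣ e₁) (sym (+-identityʳ _))) ⟩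
      ℤ.∣ e₁ ∣ + 0 + ℤ.∣ + 2 ℤ.* gap n ∣           ∎)
    b₁ (≤-trans (≤-reflexive (*-zeroʳ n)) z≤n)
  , bounded-suc k (row Errors.e₂ (suc n)) e₂ e₃ 8 ≤-refl
    (begin
      ℤ.∣ + 2 ℤ.* row Errors.e₂ (suc n) ∣          ≡⟨ cong ℤ.∣_∣ eq₂ ⟩
      ℤ.∣ e₂ ℤ.- e₃ ℤ.+ + 8 ℤ.* gap n ∣            ≤⟨ ℤ.∣i+j∣≤∣i∣+∣j∣ (e₂ ℤ.- e₃) (+ 8 ℤ.* gap n) ⟩
      ℤ.∣ e₂ ℤ.- e₃ ∣ + ℤ.∣ + 8 ℤ.* gap n ∣        ≤⟨ +-monoˡ-≤ _ (ℤ.∣i-j∣≤∣i∣+∣j∣ e₂ e₃) ⟩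
      ℤ.∣ e₂ ∣ + ℤ.∣ e₃ ∣ + ℤ.∣ + 8 ℤ.* gap n ∣    ∎)
    b₂ b₃
  , bounded-suc k (row Errors.e₃ (suc n)) e₂ e₃ 6 (from-yes (6 ≤? 8))
    (begin
      ℤ.∣ + 2 ℤ.* row Errors.e₃ (suc n) ∣          ≡⟨ cong ℤ.∣_∣ eq₃ ⟩
      ℤ.∣ e₂ ℤ.+ e₃ ℤ.- + 6 ℤ.* gap n ∣            ≤⟨ ℤ.∣i-j∣≤∣i∣+∣j∣ (e₂ ℤ.+ e₃) (+ 6 ℤ.* gap n) ⟩
      ℤ.∣ e₂ ℤ.+ e₃ ∣ + ℤ.∣ + 6 ℤ.* gap n ∣        ≤⟨ +-monoˡ-≤ _ (ℤ.∣i+j∣≤∣i∣+∣j∣ e₂ e₃) ⟩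
      ℤ.∣ e₂ ∣ + ℤ.∣ e₃ ∣ + ℤ.∣ + 6 ℤ.* gap n ∣    ∎)
    b₂ b₃
  where
  open ≤-Reasoning
  n = 2 + k
  e₁ = row Errors.e₁ n
  e₂ = row Errors.e₂ n
  e₃ = row Errors.e₃ n

-- Distance from the limit

cat-suc-≥ : ∀ n → cat n ≤ cat (suc n)
cat-suc-≥ n = subst (cat n ≤_) (sym (trans (β-suc (suc n) 0) (β-suc (suc n) 1))) (m≤m+n (cat n) _)

arithCount-defect : ∀ l → let n = 3 + l in
  + arithCount l ℤ.* + 14400 ℤ.+ ℤ.- (+ 76523) ℤ.* + cat n ≡
  + 55125 ℤ.* gap (2 + l) ℤ.- + 24300 ℤ.* gap (1 + l) ℤ.+ + 3600 ℤ.* gap l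
    ℤ.+ + 400 ℤ.* row Errors.e₁ n ℤ.+ + 288 ℤ.* row Errors.e₂ n
arithCount-defect l = Errors.defect (+ arithCount l) (+ t) (+ b) (+ a) (+ z)
  (+ x 0) (+ x 1) (+ x 2) (+ x 3)
  {gap (2 + l)} {gap (1 + l)} {gap l} {row Errors.e₁ (3 + l)} {row Errors.e₂ (3 + l)}
  integral (cat-residues (3 + l))
  refl refl refl refl refl
  where
  open ≡-Reasoning
  t = cat (3 + l)
  b = cat (2 + l)
  a = cat (1 + l)
  z = cat l
  x = residueSum (3 + l)
  rest = β (3 + l) 4 + ballotSum (2 + l)
  -- Both are totals of the entries at 4, 8, 12, ...; the entry at 0 vanishes.
  rest≡x₀ : rest ≡ x 0
  rest≡x₀ = trans (hasSum-unique (hasSum-ballotSum (2 + l)) (hasSum-residue (3 + l) 4)) (sym (residueSum-4 (3 + l) 0))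
  integral : + arithCount l ℤ.+ + 17 ℤ.* + b ℤ.+ + z ≡ + 9 ℤ.* + t ℤ.+ + 7 ℤ.* + a ℤ.+ + x 0
  integral = begin
    + arithCount l ℤ.+ + 17 ℤ.* + b ℤ.+ + z   ≡⟨ cong (λ y → + arithCount l ℤ.+ y ℤ.+ + z) (ℤ.pos-* 17 b) ⟨
    + (arithCount l + 17 * b + z)             ≡⟨ cong +_ (arithTotal-catalan l rest (hasSum-ballotSum (2 + l))) ⟩
    + (9 * t + 7 * a + rest)          ≡⟨ cong (λ y → + (9 * t + 7 * a + y)) rest≡x₀ ⟩
    + (9 * t) ℤ.+ + (7 * a) ℤ.+ + x 0
      ≡⟨ cong₂ (λ y w → y ℤ.+ w ℤ.+ + x 0) (ℤ.pos-* 9 t) (ℤ.pos-* 7 a) ⟩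
    + 9 ℤ.* + t ℤ.+ + 7 ℤ.* + a ℤ.+ + x 0 ∎

weighted-bound : ∀ n t c₁ c₂ c₃ c₄ c₅ i₁ i₂ i₃ i₄ i₅ →
  n * ℤ.∣ i₁ ∣ ≤ 6 * t → n * ℤ.∣ i₂ ∣ ≤ 6 * t → n * ℤ.∣ i₃ ∣ ≤ 6 * t →
  n * ℤ.∣ i₄ ∣ ≤ 20 * t → n * ℤ.∣ i₅ ∣ ≤ 20 * t →
  n * ℤ.∣ + c₁ ℤ.* i₁ ℤ.- + c₂ ℤ.* i₂ ℤ.+ + c₃ ℤ.* i₃ ℤ.+ + c₄ ℤ.* i₄ ℤ.+ + c₅ ℤ.* i₅ ∣
    ≤ (6 * (c₁ + c₂ + c₃) + 20 * (c₄ + c₅)) * t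
weighted-bound n t c₁ c₂ c₃ c₄ c₅ i₁ i₂ i₃ i₄ i₅ b₁ b₂ b₃ b₄ b₅ = begin
  n * ℤ.∣ j₁ ℤ.- j₂ ℤ.+ j₃ ℤ.+ j₄ ℤ.+ j₅ ∣
    ≤⟨ *-monoʳ-≤ n triangle ⟩
  n * (ℤ.∣ j₁ ∣ + ℤ.∣ j₂ ∣ + ℤ.∣ j₃ ∣ + ℤ.∣ j₄ ∣ + ℤ.∣ j₅ ∣)
    ≡⟨ distribute n ℤ.∣ j₁ ∣ ℤ.∣ j₂ ∣ ℤ.∣ j₃ ∣ ℤ.∣ j₄ ∣ ℤ.∣ j₅ ∣ ⟩
  n * ℤ.∣ j₁ ∣ + n * ℤ.∣ j₂ ∣ + n * ℤ.∣ j₃ ∣ + n * ℤ.∣ j₄ ∣ + n * ℤ.∣ j₅ ∣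
    ≤⟨ +-mono-≤ (+-mono-≤ (+-mono-≤ (+-mono-≤ (scale c₁ i₁ b₁) (scale c₂ i₂ b₂)) (scale c₃ i₃ b₃))
        (scale c₄ i₄ b₄)) (scale c₅ i₅ b₅) ⟩
  c₁ * (6 * t) + c₂ * (6 * t) + c₃ * (6 * t) + c₄ * (20 * t) + c₅ * (20 * t)
    ≡⟨ collect c₁ c₂ c₃ c₄ c₅ t ⟩
  (6 * (c₁ + c₂ + c₃) + 20 * (c₄ + c₅)) * t ∎
  where
  open ≤-Reasoning
  j₁ = + c₁ ℤ.* i₁
  j₂ = + c₂ ℤ.* i₂
  j₃ = + c₃ ℤ.* i₃
  j₄ = + c₄ ℤ.* i₄
  j₅ = + c₅ ℤ.* i₅
  triangle : ℤ.∣ j₁ ℤ.- j₂ ℤ.+ j₃ ℤ.+ j₄ ℤ.+ j₅ ∣ ≤ ℤ.∣ j₁ ∣ + ℤ.∣ j₂ ∣ + ℤ.∣ j₃ ∣ + ℤ.∣ j₄ ∣ + ℤ.∣ j₅ ∣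
  triangle =
    ≤-trans (ℤ.∣i+j∣≤∣i∣+∣j∣ (j₁ ℤ.- j₂ ℤ.+ j₃ ℤ.+ j₄) j₅) (+-monoˡ-≤ ℤ.∣ j₅ ∣
    (≤-trans (ℤ.∣i+j∣≤∣i∣+∣j∣ (j₁ ℤ.- j₂ ℤ.+ j₃) j₄) (+-monoˡ-≤ ℤ.∣ j₄ ∣
    (≤-trans (ℤ.∣i+j∣≤∣i∣+∣j∣ (j₁ ℤ.- j₂) j₃) (+-monoˡ-≤ ℤ.∣ j₃ ∣
    (ℤ.∣i-j∣≤∣i∣+∣j∣ j₁ j₂))))))
  distribute : ∀ n a b c d e → n * (a + b + c + d + e) ≡ n * a + n * b + n * c + n * d + n * e
  distribute = solve-∀
  collect : ∀ c₁ c₂ c₃ c₄ c₅ t → c₁ * (6 * t) + c₂ * (6 * t) + c₃ * (6 * t) + c₄ * (20 * t) + c₅ * (20 * t)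
    ≡ (6 * (c₁ + c₂ + c₃) + 20 * (c₄ + c₅)) * t
  collect = solve-∀
  swap : ∀ n c x → n * (c * x) ≡ c * (n * x)
  swap = solve-∀
  scale : ∀ c i {y} → n * ℤ.∣ i ∣ ≤ y → n * ℤ.∣ + c ℤ.* i ∣ ≤ c * y
  scale c i {y} b = begin
    n * ℤ.∣ + c ℤ.* i ∣   ≡⟨ cong (n *_) (ℤ.abs-* (+ c) i) ⟩
    n * (c * ℤ.∣ i ∣)     ≡⟨ swap n c ℤ.∣ i ∣ ⟩
    c * (n * ℤ.∣ i ∣)     ≤⟨ *-monoʳ-≤ c b ⟩
    c * y                 ∎

-- Cleared of denominators: the ratio is within 36 / n of its limit on the graph with n = 2 + l.
arithCount-close : ∀ l → let n = 3 + l in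
  (2 + l) * ℤ.∣ + arithCount l ℤ.* + 14400 ℤ.+ ℤ.- (+ 76523) ℤ.* + cat n ∣ ≤ 36 * (cat n * 14400)
arithCount-close l = begin
  (2 + l) * ℤ.∣ + arithCount l ℤ.* + 14400 ℤ.+ ℤ.- (+ 76523) ℤ.* + t ∣
    ≡⟨ cong (λ i → (2 + l) * ℤ.∣ i ∣) (arithCount-defect l) ⟩
  _ ≤⟨ weighted-bound (2 + l) t 55125 24300 3600 400 288
         (gap (2 + l)) (gap (1 + l)) (gap l) (row Errors.e₁ (3 + l)) (row Errors.e₂ (3 + l))
         (weaken 2 (gap (2 + l)) (gap≤ (2 + l) cat₂≤t))
         (weaken 1 (gap (1 + l)) (gap≤ (1 + l) cat₁≤t))
         (weaken 0 (gap l) (gap≤ l (≤-trans (cat-suc-≥ l) cat₁≤t)))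
         (weaken 1 (row Errors.e₁ (3 + l)) (proj₁ (rows-bounded (suc l))))
         (weaken 1 (row Errors.e₂ (3 + l)) (proj₁ (proj₂ (rows-bounded (suc l))))) ⟩
  (6 * (55125 + 24300 + 3600) + 20 * (400 + 288)) * t
    -- The weighted total is 511910, and 36 * 14400 = 518400.
    ≤⟨ *-monoˡ-≤ t (≤ᵇ⇒≤ (6 * (55125 + 24300 + 3600) + 20 * (400 + 288)) (36 * 14400) tt) ⟩
  36 * 14400 * t
    ≡⟨ regroup 36 14400 t ⟩
  36 * (t * 14400) ∎
  where
  open ≤-Reasoning
  t = cat (3 + l)
  cat₂≤t : cat (2 + l) ≤ t
  cat₂≤t = cat-suc-≥ (2 + l)
  cat₁≤t : cat (1 + l) ≤ t
  cat₁≤t = ≤-trans (cat-suc-≥ (1 + l)) cat₂≤t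
  gap≤ : ∀ j → cat j ≤ t → (2 + j) * ℤ.∣ gap j ∣ ≤ 6 * t
  gap≤ j cat≤t = ≤-trans (≤-reflexive (∣gap∣ j)) (*-monoʳ-≤ 6 cat≤t)
  weaken : ∀ c i {y} → (c + (2 + l)) * ℤ.∣ i ∣ ≤ y → (2 + l) * ℤ.∣ i ∣ ≤ y
  weaken c i = ≤-trans (*-monoˡ-≤ ℤ.∣ i ∣ (m≤n+m (2 + l) c))
  regroup : ∀ a b t → a * b * t ≡ a * (t * b)
  regroup = solve-∀

-- The difference is at most k / n, which is below the reciprocal of the denominator of ε, hence
-- below ε. Unnormalised rationals keep the difference as an explicit fraction.
quotient-close : ∀ n k N t c d (ε : ℚ) → 0ℚ ℚ.< ε →
  n * ℤ.∣ + N ℤ.* + suc d ℤ.+ ℤ.- (+ c) ℤ.* + suc t ∣ ≤ k * (suc t * suc d) →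
  k * ℚ.↧ₙ ε < n → ℚ.∣ (+ N ℚ./ suc t) ℚ.- (+ c ℚ./ suc d) ∣ ℚ.< ε
quotient-close _ _ N t c d (mkℚ (+ 0) _ _) 0<ε _ _ with () ← ℚ.positive 0<ε
quotient-close _ _ N t c d (mkℚ (ℤ.-[1+ _ ]) _ _) 0<ε _ _ with () ← ℚ.positive 0<ε
quotient-close n k N t c d ε@(mkℚ (+ suc p) q _) 0<ε bound kq<n =
  ℚ.toℚᵘ-cancel-< (ℚᵘ.<-respˡ-≃ (ℚᵘ.≃-sym toℚᵘ-difference)
    (*<* (subst₂ ℤ._<_ (ℤ.pos-* E (suc q)) (ℤ.pos-* (suc p) (suc t * suc d)) (ℤ.+<+ E<))))
  where
  E = ℤ.∣ + N ℤ.* + suc d ℤ.+ ℤ.- (+ c) ℤ.* + suc t ∣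
  open ≤-Reasoning
  regroup₁ : ∀ n E q → n * (E * q) ≡ n * E * q
  regroup₁ = solve-∀
  regroup₂ : ∀ k x q → k * x * q ≡ k * q * x
  regroup₂ = solve-∀
  regroup₃ : ∀ n p x → n * x + p * (n * x) ≡ n * (suc p * x)
  regroup₃ = solve-∀
  E< : E * suc q < suc p * (suc t * suc d)
  E< = *-cancelˡ-< n _ _ (begin-strict
    n * (E * suc q)              ≡⟨ regroup₁ n E (suc q) ⟩
    n * E * suc q                ≤⟨ *-monoˡ-≤ (suc q) bound ⟩
    k * (suc t * suc d) * suc q  ≡⟨ regroup₂ k (suc t * suc d) (suc q) ⟩
    k * suc q * (suc t * suc d)  <⟨ *-monoˡ-< (suc t * suc d) kq<n ⟩
    n * (suc t * suc d)          ≤⟨ m≤m+n _ (p * (n * (suc t * suc d))) ⟩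
    n * (suc t * suc d) + p * (n * (suc t * suc d)) ≡⟨ regroup₃ n p (suc t * suc d) ⟩
    n * (suc p * (suc t * suc d)) ∎)
  x = + N ℚ./ suc t
  y = + c ℚ./ suc d
  toℚᵘ-difference : ℚ.toℚᵘ ℚ.∣ x ℚ.- y ∣ ℚᵘ.≃ ℚᵘ.∣ mkℚᵘ (+ N) t ℚᵘ.- mkℚᵘ (+ c) d ∣
  toℚᵘ-difference = ℚᵘ.≃-trans (ℚ.toℚᵘ-homo-∣-∣ (x ℚ.- y)) (ℚᵘ.∣-∣-cong
    (ℚᵘ.≃-trans (ℚ.toℚᵘ-homo-+ x (ℚ.- y)) (ℚᵘ.+-cong (ℚ.toℚᵘ-fromℚᵘ (mkℚᵘ (+ N) t))
      (ℚᵘ.≃-trans (ℚ.toℚᵘ-homo‿- y) (ℚᵘ.-‿cong (ℚ.toℚᵘ-fromℚᵘ (mkℚᵘ (+ c) d)))))))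

-- Positivity of `t` excludes the default value of `÷ℕ`.
ratio-close : ∀ n k N t c d (ε : ℚ) → 0ℚ ℚ.< ε → 0 < t →
  n * ℤ.∣ + N ℤ.* + suc d ℤ.+ ℤ.- (+ c) ℤ.* + t ∣ ≤ k * (t * suc d) →
  k * ℚ.↧ₙ ε < n → ℚ.∣ (N ÷ℕ t) ℚ.- (+ c ℚ./ suc d) ∣ ℚ.< ε
ratio-close n k N (suc t) c d ε 0<ε _ = quotient-close n k N t c d ε 0<ε

cat>0 : ∀ n → 0 < cat n
cat>0 zero    = s≤s z≤n
cat>0 (suc n) = <-≤-trans (cat>0 n) (cat-suc-≥ n)

theorem4p3 : ((n : ℕ) → 2 ≤ n →
    Σ ℕ λ N → HasCount (IsArith (P2 n)) N × (+ N ≡ arithFormula n))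
    ×
    ((count : ℕ → ℕ) →
    ((n : ℕ) → 2 ≤ n → HasCount (IsArith (P2 n)) (count n)) →
    ConvergesTo (λ n → count n ÷ℕ catalan (suc n)) ((+ 76523) ℚ./ 14400))
theorem4p3 = exact , limit
  where
  exact : ∀ n → 2 ≤ n → Σ ℕ λ N → HasCount (IsArith (P2 n)) N × (+ N ≡ arithFormula n)
  exact (suc (suc l)) _ = arithCount l , count-arithCount l , arithCount≡formula l
  exact 1 (s≤s ())
  limit : (count : ℕ → ℕ) → ((n : ℕ) → 2 ≤ n → HasCount (IsArith (P2 n)) (count n)) →
          ConvergesTo (λ n → count n ÷ℕ catalan (suc n)) ((+ 76523) ℚ./ 14400)
  limit count counts ε 0<ε = 2 + 36 * ℚ.↧ₙ ε , close
    where
    close : ∀ n → 2 + 36 * ℚ.↧ₙ ε ≤ n → ℚ.∣ (count n ÷ℕ catalan (suc n)) ℚ.- ((+ 76523) ℚ./ 14400) ∣ ℚ.< ε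
    close (suc (suc l)) (s≤s (s≤s large)) =
      subst₂ (λ N t → ℚ.∣ (N ÷ℕ t) ℚ.- ((+ 76523) ℚ./ 14400) ∣ ℚ.< ε)
        -- The given counting function must agree with `arithCount`.
        (count-unique (count-arithCount l) (counts (2 + l) (s≤s (s≤s z≤n))))
        (sym (catalan≡β (3 + l)))
        (ratio-close (2 + l) 36 (arithCount l) (cat (3 + l)) 76523 14399 ε 0<ε (cat>0 (3 + l))
          (arithCount-close l) (s≤s (m≤n⇒m≤1+n large)))
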